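{- For every $n\ge 1$ there is a bijection $\Phi_n$ from the set of PDSAWs in the symmetric wedge with $n$ east steps to the set of matchings of $[2n]=\{1,\dots,2n\}$ such that, for every such PDSAW $P$ and all integers $N$, $A\in\{0,1\}$, $M$, the path $P$ has - exactly $N$ north steps, - area enclosed by $P$ and the line $y=-x$ of parity $A$, and - last descent of length $M-1$ if and only if the matching $\Phi_n(P)$ has - exactly $N$ nestings, - number of crossings of parity $A$, and - $1$ matched with $M$. Moreover, the bijections $\Phi_n$ ($n\ge1$) can be chosen so that factors are preserved with their order reversed (in particular the last factor of the PDSAW is mapped to the first factor of the matching): if $P_1,P_2,\dots,P_r$ are the consecutive prime factors of $P$, with $P_i$ having $n_i$ east steps, then the consecutive prime factors of the matching $\Phi_n(P)$, read from left to right, are $\Phi_{n_r}(P_r),\Phi_{n_{r-1}}(P_{r-1}),\dots,\Phi_{n_1}(P_1)$ (where each $P_i$ is translated so as to start at the origin, and each factor of the matching is relabelled order-preservingly to a matching of an initial interval $[2n_i]$).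
   Context: A partially directed self avoiding walk (PDSAW) is a walk in the plane starting at the origin and taking unit east, north and south steps, where a north step is never immediately followed or preceded by a south step. A PDSAW in the symmetric wedge is a PDSAW that stays within the (closed) wedge $\{(x,y): -x\le y\le x\}$ and ends at some point of the line $y=-x$; with $n$ east steps it therefore ends at $(n,-n)$. Such a walk is determined by the $y$-coordinates of its east steps. The length of the last descent is the number of south steps after the last east step. The area enclosed by the path and the line $y=-x$ is the number of full unit lattice squares lying between the line $y=-x$ and the path (triangles are disregarded). A matching of $[2n]$ is a partition of $[2n]$ into $n$ two-element blocks (matched pairs). A crossing is a pair of matched pairs $\{i,j\},\{k,l\}$ with $i<k<j<l$; a nesting is a pair of matched pairs $\{i,j\},\{k,l\}$ with $i<k<l<j$. A factor of a PDSAW in the symmetric wedge is a sub-path starting at $(a,-a)$ and ending at $(b,-b)$, for some $a<b$, such that all east steps of the PDSAW after the point $(a,-a)$ are (weakly) below the line $y=x-2a$, and all east steps of the PDSAW after the point $(b,-b)$ are (weakly) below the line $y=x-2b$. A factor of a matching is a sub-matching on an interval $\{a,a+1,\dots,b\}$ such that all elements of this interval are matched within the interval. A factor is prime if it contains no smaller factor. Every PDSAW in the symmetric wedge, and every matching, is the concatenation of its consecutive prime factors; the last factor of a PDSAW is its last prime factor and the first factor of a matching is its first (leftmost) prime factor.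
   Formalization: For matchings, a prime factor is taken to be one that is not a concatenation of two smaller factors; under the literal "contains no smaller factor", the matching {1,4},{2,3} would not be a concatenation of prime factors. -}

module Defs where

open import Data.Integer as ℤ using (ℤ; +_; 0ℤ; 1ℤ; ∣_∣)
open import Data.List using (List; []; _∷_; _++_; map; length; filter; takeWhile; reverse; concatMap; upTo; cartesianProduct)
open import Data.List.Membership.Propositional using (_∈_)
open import Data.List.Relation.Binary.Permutation.Propositional using (_↭_)
open import Data.List.Relation.Unary.All using (All)
open import Data.List.Relation.Unary.Linked using (Linked)
open import Data.Nat using (ℕ; suc; _+_; _*_; _≤_; _<_; _≤?_; _<?_; NonZero)
open import Data.Nat.ListAction using (sum)
open import Data.Product using (∃; _×_; _,_; proj₁; proj₂)
open import Function.Bundles using (_⇔_)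
open import Level using (0ℓ)
open import Relation.Binary.Bundles using (Setoid)
import Relation.Binary.Construct.On as On
open import Relation.Binary.Definitions using (DecidableEquality)
open import Relation.Binary.PropositionalEquality using (_≡_; refl; setoid)
open import Relation.Nullary using (¬_; Dec; yes; no; ¬?)
open import Relation.Nullary.Decidable using (_×-dec_)

private
  variable
    n : ℕ

data Step : Set where
  east north south : Step

_≟_ : DecidableEquality Step
east  ≟ east  = yes refl
east  ≟ north = no λ ()
east  ≟ south = no λ ()
north ≟ east  = no λ ()
north ≟ north = yes refl
north ≟ south = no λ ()
south ≟ east  = no λ ()
south ≟ north = no λ ()
south ≟ south = yes refl

Point : Set
Point = ℤ × ℤ

origin : Point
origin = 0ℤ , 0ℤ

move : Step → Point → Point
move east  (x , y) = x ℤ.+ 1ℤ , y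
move north (x , y) = x , y ℤ.+ 1ℤ
move south (x , y) = x , y ℤ.- 1ℤ

endpoint : Point → List Step → Point
endpoint p []      = p
endpoint p (s ∷ w) = endpoint (move s p) w

vertices : Point → List Step → List Point
vertices p []      = p ∷ []
vertices p (s ∷ w) = p ∷ vertices (move s p) w

-- An east step is recorded by its starting (left) point.
eastSteps : Point → List Step → List Point
eastSteps p []          = []
eastSteps p (east  ∷ w) = p ∷ eastSteps (move east p) w
eastSteps p (north ∷ w) = eastSteps (move north p) w
eastSteps p (south ∷ w) = eastSteps (move south p) w

MayFollow : Step → Step → Set
MayFollow s t = ¬ (s ≡ north × t ≡ south) × ¬ (s ≡ south × t ≡ north)

InWedge : Point → Set
InWedge (x , y) = ℤ.- x ℤ.≤ y × y ℤ.≤ x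

OnAntidiagonal : Point → Set
OnAntidiagonal (x , y) = y ≡ ℤ.- x

count : Step → List Step → ℕ
count s w = length (filter (s ≟_) w)

-- The wedge is convex, so a walk stays in it iff its vertices do.
record PDSAW (n : ℕ) : Set where
  field
    steps      : List Step
    noReversal : Linked MayFollow steps
    inWedge    : All InWedge (vertices origin steps)
    ends       : OnAntidiagonal (endpoint origin steps)
    eastCount  : count east steps ≡ n

-- Two walks are equal when they take the same steps.
PDSAWs : ℕ → Setoid 0ℓ 0ℓ
PDSAWs n = On.setoid {B = PDSAW n} (setoid (List Step)) PDSAW.steps

northSteps : PDSAW n → ℕ
northSteps P = count north (PDSAW.steps P)

lastDescent : PDSAW n → ℕ
lastDescent P = count south (takeWhile (λ s → ¬? (s ≟ east)) (reverse (PDSAW.steps P)))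

-- Below the east step from (x , y) to (x + 1 , y), the full unit squares above
-- the line y = - x are [x , x + 1] × [j , j + 1] with - x ≤ j < y.  There are
-- x + y of them, a nonnegative number inside the wedge.
area : PDSAW n → ℕ
area P = sum (map (λ (x , y) → ∣ x ℤ.+ y ∣) (eastSteps origin (PDSAW.steps P)))

corner : ℕ → Point
corner a = + a , ℤ.- (+ a)

-- An east step lies weakly below y = x - 2a iff its left end does.
WeaklyBelow : ℕ → Point → Set
WeaklyBelow a (x , y) = y ℤ.≤ x ℤ.- + (2 * a)

-- Words of steps are translation invariant, so w is both the sub-path of P from
-- corner a to corner b and its translate to the origin.
record IsPathFactor (P : PDSAW n) (a b : ℕ) (w : List Step) : Set where
  field
    before after : List Step
    split        : PDSAW.steps P ≡ before ++ w ++ after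
    start        : endpoint origin before ≡ corner a
    end          : endpoint (corner a) w ≡ corner b
    nonempty     : a < b
    belowStart   : All (WeaklyBelow a) (eastSteps (corner a) (w ++ after))
    belowEnd     : All (WeaklyBelow b) (eastSteps (corner b) after)

record IsPrimePathFactor (P : PDSAW n) (a b : ℕ) (w : List Step) : Set where
  field
    isFactor : IsPathFactor P a b w
    minimal  : ∀ a′ b′ w′ → IsPathFactor P a′ b′ w′ → a ≤ a′ → b′ ≤ b → a′ ≡ a × b′ ≡ b

SomePositive : (ℕ → Set) → Set
SomePositive F = ∃ λ k → NonZero k × F k

data PrimePathFactorsFrom (P : PDSAW n) : ℕ → List (SomePositive PDSAW) → Set where
  []  : PrimePathFactorsFrom P n []
  _∷_ : ∀ {a k k≢0 Q Qs} →
        IsPrimePathFactor P a (a + k) (PDSAW.steps Q) →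
        PrimePathFactorsFrom P (a + k) Qs →
        PrimePathFactorsFrom P a ((k , k≢0 , Q) ∷ Qs)

PrimePathFactors : PDSAW n → List (SomePositive PDSAW) → Set
PrimePathFactors P = PrimePathFactorsFrom P 0

Block : Set
Block = ℕ × ℕ

-- A block {i , j} is stored as (i , j) with i < j, and the blocks are listed by
-- increasing smaller element; this makes the list determined by the partition.
-- The permutation says that each element of {1 , … , 2n} is in exactly one block.
record Matching (n : ℕ) : Set where
  field
    blocks    : List Block
    ordered   : All (λ (i , j) → i < j) blocks
    sorted    : Linked (λ p q → proj₁ p < proj₁ q) blocks
    partition : concatMap (λ (i , j) → i ∷ j ∷ []) blocks ↭ map suc (upTo (2 * n))

Matchings : ℕ → Setoid 0ℓ 0ℓ
Matchings n = On.setoid {B = Matching n} (setoid (List Block)) Matching.blocks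

Crosses : Block × Block → Set
Crosses ((i , j) , (k , l)) = i < k × k < j × j < l

crosses? : ∀ pq → Dec (Crosses pq)
crosses? ((i , j) , (k , l)) = i <? k ×-dec k <? j ×-dec j <? l

Nests : Block × Block → Set
Nests ((i , j) , (k , l)) = i < k × k < l × l < j

nests? : ∀ pq → Dec (Nests pq)
nests? ((i , j) , (k , l)) = i <? k ×-dec k <? l ×-dec l <? j

-- Crosses and Nests hold for at most one ordering of two blocks, so every
-- crossing or nesting pair is counted once.
crossings nestings : Matching n → ℕ
crossings μ = length (filter crosses? (cartesianProduct (Matching.blocks μ) (Matching.blocks μ)))
nestings  μ = length (filter nests?   (cartesianProduct (Matching.blocks μ) (Matching.blocks μ)))

OneMatchedWith : Matching n → ℤ → Set
OneMatchedWith μ m = ∃ λ j → m ≡ + j × (1 , j) ∈ Matching.blocks μ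

-- The interval {a + 1 , … , b} is given by the pair a , b.
InInterval : ℕ → ℕ → ℕ → Set
InInterval a b i = a < i × i ≤ b

record IsMatchingFactor (μ : Matching n) (a b : ℕ) : Set where
  field
    nonempty : a < b
    inRange  : b ≤ 2 * n
    closed   : All (λ (i , j) → InInterval a b i ⇔ InInterval a b j) (Matching.blocks μ)

-- "Contains no smaller factor" is meant with respect to concatenation: the
-- factor is not a concatenation of two smaller ones.  If all closed
-- subintervals were considered, {1,4},{2,3} would not be a concatenation of
-- prime factors, because of the nested interval {2 , 3}.
record IsPrimeMatchingFactor (μ : Matching n) (a b : ℕ) : Set where
  field
    isFactor : IsMatchingFactor μ a b
    minimal  : ∀ c → ¬ (IsMatchingFactor μ a c × IsMatchingFactor μ c b)

-- ν is the sub-matching of μ on {a + 1 , … , b}, relabelled to start at 1.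
IsRestriction : ∀ {k} → Matching n → ℕ → ℕ → Matching k → Set
IsRestriction μ a b ν =
  map (λ (i , j) → a + i , a + j) (Matching.blocks ν)
    ≡ filter (λ (i , _) → a <? i ×-dec i ≤? b) (Matching.blocks μ)

data PrimeMatchingFactorsFrom (μ : Matching n) : ℕ → List (SomePositive Matching) → Set where
  []  : PrimeMatchingFactorsFrom μ (2 * n) []
  _∷_ : ∀ {a k k≢0 ν νs} →
        IsPrimeMatchingFactor μ a (a + 2 * k) × IsRestriction μ a (a + 2 * k) ν →
        PrimeMatchingFactorsFrom μ (a + 2 * k) νs →
        PrimeMatchingFactorsFrom μ a ((k , k≢0 , ν) ∷ νs)

PrimeMatchingFactors : Matching n → List (SomePositive Matching) → Set
PrimeMatchingFactors μ = PrimeMatchingFactorsFrom μ 0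

{-# OPTIONS --safe #-}
module Submission where

-- Record the k-th east step of a path by its height a above y = - x, so that
-- 0 ≤ a ≤ 2 (k - 1) is the only restriction.  The area is the sum of the a's, an
-- east step at height a after one at height a′ costs a ∸ (a′ + 1) north steps, and
-- the last descent is one more than the last a.
--
-- A matching is likewise built by repeatedly adding a new leftmost arc {1 , p + 2}.
-- This adds c crossings and d nestings with c + 2 d = p, where d is the number of
-- closers among the first p old points.  To obtain a ∸ (a′ + 1) nestings for p = a,
-- when the previous arc was added with p = a′, the first a points of the old
-- matching are rearranged beforehand: the first letter of its word is carried to
-- position a by local moves that keep the number of crossings and change the
-- number of nestings by exactly the amount needed.  All moves act on the first a
-- points only, so concatenations are respected.
open import Defs
open import Data.Empty using (⊥-elim)
open import Data.Fin using (Fin; toℕ)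
open import Data.Integer as ℤ using (ℤ; _-_; 0ℤ; 1ℤ; ∣_∣)
import Data.Integer.Properties as ℤ
open import Data.Integer.Tactic.RingSolver using () renaming (solve-∀ to ℤ-solve-∀)
open import Data.List using (List; []; _∷_; _++_; length; map; filter; takeWhile; reverse; reverseAcc; _ʳ++_; replicate; upTo; applyUpTo; cartesianProduct; concatMap)
open import Data.List.Membership.Propositional using (_∈_)
open import Data.List.Membership.Propositional.Properties using (∈-map⁻; ∈-upTo⁻)
open import Data.List.Properties
open import Data.List.Relation.Binary.Permutation.Propositional as Perm using (_↭_; prep; ↭-sym; ↭-trans; ↭-refl; ↭-reflexive)
open import Data.List.Relation.Binary.Permutation.Propositional.Properties using (drop-∷; ∈-resp-↭; ↭-empty-inv; ↭-reverse) renaming (map⁺ to ↭-map⁺)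
open import Data.List.Relation.Unary.All as All using (All; []; _∷_)
import Data.List.Relation.Unary.All.Properties as All
open import Data.List.Relation.Unary.Any using (here; there)
open import Data.List.Relation.Unary.Linked as Linked using (Linked; []; [-]; _∷_)
import Data.List.Relation.Unary.Linked.Properties as Linked
open import Data.Nat hiding (_≟_; _%_)
open import Data.Nat.DivMod using (_%_; [m+kn]%n≡m%n)
open import Data.Nat.ListAction using (sum)
open import Data.Nat.ListAction.Properties using (sum-↭)
open import Data.Nat.Properties hiding (_≟_)
open import Data.Nat.Tactic.RingSolver using (solve-∀)
open import Data.Product using (∃; ∃₂; _×_; _,_; proj₁; proj₂; Σ-syntax)
open import Data.Sum using (_⊎_; inj₁; inj₂)
open import Function using (_∘_; id; _⇔_; mk⇔; Equivalence; Bijection)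
open import Level using (0ℓ)
open import Relation.Binary.Definitions using (tri<; tri≈; tri>)
open import Relation.Binary.PropositionalEquality
open import Relation.Nullary using (¬_; yes; no; Dec; ¬?)
open import Relation.Nullary.Decidable using (_×-dec_)
open import Relation.Unary using (Pred; Decidable)

-- Words with labelled closers

-- The carried letter is the opener of the arc added just before, and its own closer stands `a′`
-- letters further on. Until the two meet, nothing is gained: a closer that the opener passes loses
-- one nesting, and it regains it by ending up inside the new arc. An opener never passes its own
-- closer; the closer is carried on instead, and from there every step is worth one more nesting.
-- This leaves `a ∸ (a′ + 1)`, truncated subtraction included.
--
-- Labels are the right coordinates because the crossings are their sum: a move that permutes
-- labels, or trades a unit between two of them, keeps the crossings automatically. Insertion with
-- rearrangement and insertion without it code the same words by the same lists, so the bijection is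
-- one coding followed by the inverse of the other. By `c + 2 d = p`, both codings give the
-- crossings the parity of the sum of the list, which for paths is the area.
--
-- Arcs are added on the left while east steps are added on the right; hence the reversal of the
-- factors.

data Letter : Set where
  opener : Letter
  closer : ℕ → Letter

Word : Set
Word = List Letter

heightAfter : ℕ → Letter → ℕ
heightAfter h opener     = suc h
heightAfter h (closer _) = pred h

-- In Labelled h w, the word w starts with h open arcs.  The label c of a closer
-- counts the open arcs to the right of the one it closes.  So c is the number
-- of crossings in which the closed arc comes first, and pred h ∸ c the number
-- of nestings in which it is the inner arc.
data Labelled : ℕ → Word → Set where
  []      : Labelled 0 []
  opener∷ : ∀ {h w} → Labelled (suc h) w → Labelled h (opener ∷ w)
  closer∷ : ∀ {h c w} → c ≤ h → Labelled h w → Labelled (suc h) (closer c ∷ w)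

nestingsW : ℕ → Word → ℕ
nestingsW h []             = 0
nestingsW h (opener   ∷ w) = nestingsW (suc h) w
nestingsW h (closer c ∷ w) = (pred h ∸ c) + nestingsW (pred h) w

crossingsW : Word → ℕ
crossingsW []             = 0
crossingsW (opener   ∷ w) = crossingsW w
crossingsW (closer c ∷ w) = c + crossingsW w

closersW : ℕ → Word → ℕ
closersW zero    w              = 0
closersW (suc q) []             = 0
closersW (suc q) (opener   ∷ w) = closersW q w
closersW (suc q) (closer _ ∷ w) = suc (closersW q w)

heightW : ℕ → ℕ → Word → ℕ
heightW zero    h w       = h
heightW (suc q) h []      = h
heightW (suc q) h (x ∷ w) = heightW q (heightAfter h x) w

-- Openers raise the height by one and closers lower it by one, so each closer among the `q` letters
-- costs two. For `h = 0` this is the relation `c + 2 d = p` of a new leftmost arc.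
heightW-closersW : ∀ {q h w} → Labelled h w → q ≤ length w →
                   heightW q h w + 2 * closersW q w ≡ h + q
heightW-closersW {zero}          _             _       = refl
heightW-closersW {suc q} {h} (opener∷ v)   (s≤s le) =
  trans (heightW-closersW v le) (sym (+-suc h q))
heightW-closersW {suc q} {suc h} {closer c ∷ w} (closer∷ _ v) (s≤s le) = begin
  heightW q h w + 2 * suc (closersW q w)     ≡⟨ lemma (heightW q h w) (closersW q w) ⟩
  2 + (heightW q h w + 2 * closersW q w)     ≡⟨ cong (2 +_) (heightW-closersW v le) ⟩
  2 + (h + q)                                ≡⟨ cong suc (+-suc h q) ⟨
  suc h + suc q                              ∎
  where
  open ≡-Reasoning
  lemma : ∀ a b → a + 2 * suc b ≡ 2 + (a + 2 * b)
  lemma = solve-∀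

-- An involution on words that keeps the sum of the labels.  It moves the first
-- letter past the second, except that an opener followed by the closer of the
-- leftmost open arc is left alone.  Two adjacent closers exchange their labels,
-- shifted to c + 1 and l - 1 when l + c ≥ pred h to make this a bijection: l is less
-- than h but c is less than pred h.
swap : ℕ → Word → Word
swap h (opener ∷ closer c ∷ w) with c <? h
... | yes _ = closer c ∷ opener ∷ w
... | no  _ = opener ∷ closer c ∷ w
swap h (closer l ∷ opener ∷ w) = opener ∷ closer l ∷ w
swap h (closer l ∷ closer c ∷ w) with l + c <? pred h
... | yes _ = closer c ∷ closer l ∷ w
... | no  _ = closer (suc c) ∷ closer (pred l) ∷ w
swap h []                    = []
swap h (x ∷ [])              = x ∷ []
swap h (opener ∷ opener ∷ w) = opener ∷ opener ∷ w

swap-labelled : ∀ {h w} → Labelled h w → Labelled h (swap h w)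
swap-labelled {h} (opener∷ (closer∷ {c = c} c≤h v)) with c <? h
swap-labelled {suc h} (opener∷ (closer∷ _ v)) | yes (s≤s c≤h) = closer∷ c≤h (opener∷ v)
... | no _ = opener∷ (closer∷ c≤h v)
swap-labelled (closer∷ l≤h (opener∷ v)) = opener∷ (closer∷ (m≤n⇒m≤1+n l≤h) v)
swap-labelled {suc (suc h)} (closer∷ {c = l} l≤h (closer∷ {c = c} c≤h v)) with l + c <? suc h
... | yes (s≤s l+c≤h) = closer∷ (m≤n⇒m≤1+n c≤h) (closer∷ (m+n≤o⇒m≤o l l+c≤h) v)
... | no  _           = closer∷ (s≤s c≤h) (closer∷ (pred-mono-≤ l≤h) v)
swap-labelled []                        = []
swap-labelled (opener∷ (opener∷ v))     = opener∷ (opener∷ v)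
swap-labelled (closer∷ c≤h [])          = closer∷ c≤h []

-- Both ways of exchanging two closers keep `l + c`, and the branch depends on this sum alone, so
-- the second application takes the same branch. In the trading branch `l` is positive, since
-- `l = 0` would give `l + c < pred h`; there `pred` loses nothing.
swap-involutive : ∀ {h w} → Labelled h w → swap h (swap h w) ≡ w
swap-involutive {h} (opener∷ (closer∷ {c = c} c≤h v)) with c <? h
... | yes _ = refl
... | no c≮h with c <? h
...   | yes c<h = ⊥-elim (c≮h c<h)
...   | no  _   = refl
swap-involutive {suc h} (closer∷ {c = l} l≤h (opener∷ v)) with l <? suc h
... | yes _   = refl
... | no l≮h  = ⊥-elim (l≮h (s≤s l≤h))
swap-involutive {suc (suc h)} (closer∷ {c = l} l≤h (closer∷ {c = c} c≤h v)) with l + c <? suc h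
... | yes l+c<h with c + l <? suc h
...   | yes _     = refl
...   | no  c+l≮h = ⊥-elim (c+l≮h (subst (_< suc h) (+-comm l c) l+c<h))
swap-involutive {suc (suc h)} (closer∷ {c = zero} l≤h (closer∷ {c = c} c≤h v)) | no l+c≮h =
  ⊥-elim (l+c≮h (s≤s c≤h))
swap-involutive {suc (suc h)} (closer∷ {c = suc l} l≤h (closer∷ {c = c} c≤h v)) | no l+c≮h
  with suc c + l <? suc h
... | yes c+l<h = ⊥-elim (l+c≮h (subst (_< suc h) (cong suc (+-comm c l)) c+l<h))
... | no  _     = refl
swap-involutive []                    = refl
swap-involutive (opener∷ (opener∷ v)) = refl
swap-involutive (closer∷ c≤h [])      = refl

length-swap : ∀ h w → length (swap h w) ≡ length w
length-swap h (opener ∷ closer c ∷ w) with c <? h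
... | yes _ = refl
... | no  _ = refl
length-swap h (closer l ∷ opener ∷ w) = refl
length-swap h (closer l ∷ closer c ∷ w) with l + c <? pred h
... | yes _ = refl
... | no  _ = refl
length-swap h []                    = refl
length-swap h (opener ∷ [])         = refl
length-swap h (closer _ ∷ [])       = refl
length-swap h (opener ∷ opener ∷ w) = refl

swap-++ : ∀ h w w′ → 2 ≤ length w → swap h (w ++ w′) ≡ swap h w ++ w′
swap-++ h (opener ∷ closer c ∷ w) w′ _ with c <? h
... | yes _ = refl
... | no  _ = refl
swap-++ h (closer l ∷ opener ∷ w) w′ _ = refl
swap-++ h (closer l ∷ closer c ∷ w) w′ _ with l + c <? pred h
... | yes _ = refl
... | no  _ = refl
swap-++ h (opener ∷ opener ∷ w) w′ _ = refl
swap-++ h (x ∷ []) w′ (s≤s ())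

crossingsW-swap : ∀ {h w} → Labelled h w → crossingsW (swap h w) ≡ crossingsW w
crossingsW-swap {h} (opener∷ (closer∷ {c = c} c≤h v)) with c <? h
... | yes _ = refl
... | no  _ = refl
crossingsW-swap (closer∷ l≤h (opener∷ v)) = refl
crossingsW-swap {suc (suc h)} (closer∷ {c = l} l≤h (closer∷ {c = c} {w} c≤h v)) with l + c <? suc h
... | yes _ = lemma c l (crossingsW w)
  where
  lemma : ∀ a b d → a + (b + d) ≡ b + (a + d)
  lemma = solve-∀
crossingsW-swap {suc (suc h)} (closer∷ {c = zero} l≤h (closer∷ c≤h v)) | no l+c≮h =
  ⊥-elim (l+c≮h (s≤s c≤h))
crossingsW-swap {suc (suc h)} (closer∷ {c = suc l} l≤h (closer∷ {c = c} {w} c≤h v)) | no _ =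
  cong suc (lemma c l (crossingsW w))
  where
  lemma : ∀ a b d → a + (b + d) ≡ b + (a + d)
  lemma = solve-∀
crossingsW-swap []                    = refl
crossingsW-swap (opener∷ (opener∷ v)) = refl
crossingsW-swap (closer∷ c≤h [])      = refl

-- Carrying the first letter through a word

mutual
  -- Swaps at positions 0, 1, ..., `k - 1` in turn. `rotateTail` matches on the word already
  -- swapped, whose first letter is final and fixes the height for the next swap.
  rotate : ℕ → ℕ → Word → Word
  rotate zero    h w = w
  rotate (suc k) h w = rotateTail k h (swap h w)

  rotateTail : ℕ → ℕ → Word → Word
  rotateTail k h []      = []
  rotateTail k h (x ∷ w) = x ∷ rotate k (heightAfter h x) w

-- The same swaps in the opposite order, each being its own inverse.
unrotate : ℕ → ℕ → Word → Word
unrotate zero    h w       = w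
unrotate (suc k) h []      = []
unrotate (suc k) h (x ∷ w) = swap h (x ∷ unrotate k (heightAfter h x) w)

labelled-tail : ∀ {h x w} → Labelled h (x ∷ w) → Labelled (heightAfter h x) w
labelled-tail (opener∷ v)   = v
labelled-tail (closer∷ _ v) = v

labelled-∷ : ∀ {h x w w′} → Labelled h (x ∷ w) → Labelled (heightAfter h x) w′ → Labelled h (x ∷ w′)
labelled-∷ (opener∷ _)     v = opener∷ v
labelled-∷ (closer∷ c≤h _) v = closer∷ c≤h v

mutual
  rotate-labelled : ∀ k {h w} → Labelled h w → Labelled h (rotate k h w)
  rotate-labelled zero    v = v
  rotate-labelled (suc k) v = rotateTail-labelled k (swap-labelled v)

  rotateTail-labelled : ∀ k {h w} → Labelled h w → Labelled h (rotateTail k h w)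
  rotateTail-labelled k {w = []}    v = v
  rotateTail-labelled k {w = _ ∷ _} v = labelled-∷ v (rotate-labelled k (labelled-tail v))

unrotate-labelled : ∀ k {h w} → Labelled h w → Labelled h (unrotate k h w)
unrotate-labelled zero            v = v
unrotate-labelled (suc k) {w = []}    v = v
unrotate-labelled (suc k) {w = _ ∷ _} v =
  swap-labelled (labelled-∷ v (unrotate-labelled k (labelled-tail v)))

mutual
  length-rotate : ∀ k h w → length (rotate k h w) ≡ length w
  length-rotate zero    h w = refl
  length-rotate (suc k) h w = trans (length-rotateTail k h (swap h w)) (length-swap h w)

  length-rotateTail : ∀ k h w → length (rotateTail k h w) ≡ length w
  length-rotateTail k h []      = refl
  length-rotateTail k h (x ∷ w) = cong suc (length-rotate k (heightAfter h x) w)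

length-unrotate : ∀ k h w → length (unrotate k h w) ≡ length w
length-unrotate zero    h w       = refl
length-unrotate (suc k) h []      = refl
length-unrotate (suc k) h (x ∷ w) =
  trans (length-swap h (x ∷ unrotate k (heightAfter h x) w)) (cong suc (length-unrotate k (heightAfter h x) w))

mutual
  unrotate-rotate : ∀ k {h w} → Labelled h w → unrotate k h (rotate k h w) ≡ w
  unrotate-rotate zero    v = refl
  unrotate-rotate (suc k) v =
    trans (unrotate-rotateTail k (swap-labelled v)) (swap-involutive v)

  unrotate-rotateTail : ∀ k {h w} → Labelled h w →
                        unrotate (suc k) h (rotateTail k h w) ≡ swap h w
  unrotate-rotateTail k {w = []}        v = refl
  unrotate-rotateTail k {h} {w = x ∷ _} v =
    cong (swap h ∘ (x ∷_)) (unrotate-rotate k (labelled-tail v))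

rotate-unrotate : ∀ k {h w} → Labelled h w → rotate k h (unrotate k h w) ≡ w
rotate-unrotate zero            v = refl
rotate-unrotate (suc k) {w = []}    v = refl
rotate-unrotate (suc k) {h} {x ∷ w} v = begin
  rotateTail k h (swap h (swap h (x ∷ unrotate k (heightAfter h x) w)))
    ≡⟨ cong (rotateTail k h) (swap-involutive (labelled-∷ v (unrotate-labelled k (labelled-tail v)))) ⟩
  x ∷ rotate k (heightAfter h x) (unrotate k (heightAfter h x) w)
    ≡⟨ cong (x ∷_) (rotate-unrotate k (labelled-tail v)) ⟩
  x ∷ w ∎
  where open ≡-Reasoning

mutual
  -- `k` consecutive swaps read only `suc k` letters.
  rotate-++ : ∀ k h w w′ → suc k ≤ length w → rotate k h (w ++ w′) ≡ rotate k h w ++ w′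
  rotate-++ zero    h w w′ le = refl
  rotate-++ (suc k) h w w′ le = trans
    (cong (rotateTail k h) (swap-++ h w w′ (≤-trans (s≤s (s≤s z≤n)) le)))
    (rotateTail-++ k h (swap h w) w′ (subst (suc (suc k) ≤_) (sym (length-swap h w)) le))

  rotateTail-++ : ∀ k h w w′ → suc (suc k) ≤ length w →
                  rotateTail k h (w ++ w′) ≡ rotateTail k h w ++ w′
  rotateTail-++ k h (x ∷ w) w′ (s≤s le) = cong (x ∷_) (rotate-++ k (heightAfter h x) w w′ le)

crossingsW-∷ : ∀ x {w w′} → crossingsW w ≡ crossingsW w′ → crossingsW (x ∷ w) ≡ crossingsW (x ∷ w′)
crossingsW-∷ opener     eq = eq
crossingsW-∷ (closer c) eq = cong (c +_) eq

mutual
  crossingsW-rotate : ∀ k {h w} → Labelled h w → crossingsW (rotate k h w) ≡ crossingsW w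
  crossingsW-rotate zero    v = refl
  crossingsW-rotate (suc k) v =
    trans (crossingsW-rotateTail k (swap-labelled v)) (crossingsW-swap v)

  crossingsW-rotateTail : ∀ k {h w} → Labelled h w → crossingsW (rotateTail k h w) ≡ crossingsW w
  crossingsW-rotateTail k {w = []}    v = refl
  crossingsW-rotateTail k {w = x ∷ _} v =
    crossingsW-∷ x (crossingsW-rotate k (labelled-tail v))

-- The inserted closer belongs to an opener placed in front of the whole word,
-- so that every one of the h arcs open at that point is crossed.
insertCloser : ℕ → ℕ → Word → Word
insertCloser zero    h w       = closer h ∷ w
insertCloser (suc p) h []      = []
insertCloser (suc p) h (x ∷ w) = x ∷ insertCloser p (heightAfter h x) w

insertArc : ℕ → Word → Word
insertArc p w = opener ∷ insertCloser p 0 w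

-- Here `h` is the height without the leftmost arc. A closer of any other arc has `c < h`, so the
-- first one failing this closes the leftmost arc.
removeCloser : ℕ → Word → ℕ × Word
removeCloser h []             = 0 , []
removeCloser h (opener ∷ w)   = let p , w′ = removeCloser (suc h) w in suc p , opener ∷ w′
removeCloser h (closer c ∷ w) with c <? h
... | yes _ = let p , w′ = removeCloser (pred h) w in suc p , closer c ∷ w′
... | no  _ = 0 , w

removeArc : Word → ℕ × Word
removeArc []      = 0 , []
removeArc (_ ∷ w) = removeCloser 0 w

insertCloser-labelled : ∀ {p h w} → Labelled h w → p ≤ length w →
                        Labelled (suc h) (insertCloser p h w)
insertCloser-labelled {zero}  v               _        = closer∷ ≤-refl v
insertCloser-labelled {suc p} (opener∷ v)     (s≤s le) = opener∷ (insertCloser-labelled v le)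
insertCloser-labelled {suc p} (closer∷ c≤h v) (s≤s le) =
  closer∷ (m≤n⇒m≤1+n c≤h) (insertCloser-labelled v le)

removeCloser-insertCloser : ∀ {p h w} → Labelled h w → p ≤ length w →
                            removeCloser h (insertCloser p h w) ≡ (p , w)
removeCloser-insertCloser {zero} {h} v _ with h <? h
... | yes h<h = ⊥-elim (<-irrefl refl h<h)
... | no  _   = refl
removeCloser-insertCloser {suc p} (opener∷ v) (s≤s le)
  rewrite removeCloser-insertCloser v le = refl
removeCloser-insertCloser {suc p} {suc h} (closer∷ {c = c} c≤h v) (s≤s le) with c <? suc h
... | yes _ rewrite removeCloser-insertCloser v le = refl
... | no c≮h = ⊥-elim (c≮h (s≤s c≤h))

record Removed (h : ℕ) (w : Word) (r : ℕ × Word) : Set where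
  constructor removed
  field
    labelled : Labelled h (proj₂ r)
    bound    : proj₁ r ≤ length (proj₂ r)
    insert   : insertCloser (proj₁ r) h (proj₂ r) ≡ w

removeCloser-removed : ∀ {h w} → Labelled (suc h) w → Removed h w (removeCloser h w)
removeCloser-removed (opener∷ v) with removed v′ le eq ← removeCloser-removed v =
  removed (opener∷ v′) (s≤s le) (cong (opener ∷_) eq)
removeCloser-removed {h} (closer∷ {c = c} c≤h v) with c <? h
removeCloser-removed {suc h} (closer∷ {c = c} _ v) | yes (s≤s c≤h)
  with removed v′ le eq ← removeCloser-removed v =
  removed (closer∷ c≤h v′) (s≤s le) (cong (closer c ∷_) eq)
... | no c≮h = removed v z≤n (cong (λ d → closer d ∷ _) (≤-antisym (≮⇒≥ c≮h) c≤h))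

length-insertCloser : ∀ p h w → p ≤ length w → length (insertCloser p h w) ≡ suc (length w)
length-insertCloser zero    h w       _        = refl
length-insertCloser (suc p) h (x ∷ w) (s≤s le) = cong suc (length-insertCloser p (heightAfter h x) w le)

insertCloser-++ : ∀ p h w w′ → p ≤ length w → insertCloser p h (w ++ w′) ≡ insertCloser p h w ++ w′
insertCloser-++ zero    h w       w′ _        = refl
insertCloser-++ (suc p) h (x ∷ w) w′ (s≤s le) = cong (x ∷_) (insertCloser-++ p (heightAfter h x) w w′ le)

crossingsW-insertCloser : ∀ p h w → p ≤ length w →
                          crossingsW (insertCloser p h w) ≡ crossingsW w + heightW p h w
crossingsW-insertCloser zero    h w              _        = +-comm h (crossingsW w)
crossingsW-insertCloser (suc p) h (opener ∷ w)   (s≤s le) = crossingsW-insertCloser p (suc h) w le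
crossingsW-insertCloser (suc p) h (closer c ∷ w) (s≤s le) =
  trans (cong (c +_) (crossingsW-insertCloser p (pred h) w le))
        (sym (+-assoc c (crossingsW w) (heightW p (pred h) w)))

-- Each closer before the insertion point sees one more open arc to its left and gains a nesting.
-- The inserted closer belongs to the leftmost arc, which is inner to none.
nestingsW-insertCloser : ∀ {p h w} → Labelled h w → p ≤ length w →
                         nestingsW (suc h) (insertCloser p h w) ≡ nestingsW h w + closersW p w
nestingsW-insertCloser {zero} {h} {w} v _ =
  trans (cong (_+ nestingsW h w) (n∸n≡0 h)) (sym (+-identityʳ (nestingsW h w)))
nestingsW-insertCloser {suc p} (opener∷ v) (s≤s le) = nestingsW-insertCloser v le
nestingsW-insertCloser {suc p} {suc h} {closer c ∷ w} (closer∷ c≤h v) (s≤s le) = begin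
  (suc h ∸ c) + nestingsW (suc h) (insertCloser p h w)
    ≡⟨ cong₂ _+_ (+-∸-assoc 1 c≤h) (nestingsW-insertCloser v le) ⟩
  suc (h ∸ c) + (nestingsW h w + closersW p w)
    ≡⟨ lemma (h ∸ c) (nestingsW h w) (closersW p w) ⟩
  (h ∸ c) + nestingsW h w + suc (closersW p w) ∎
  where
  open ≡-Reasoning
  lemma : ∀ a b d → suc a + (b + d) ≡ a + b + suc d
  lemma = solve-∀

closersW-insertCloser-≥ : ∀ {p q} h w → p ≤ q → p ≤ length w →
                          closersW (suc q) (insertCloser p h w) ≡ suc (closersW q w)
closersW-insertCloser-≥ {zero}  h w              _         _        = refl
closersW-insertCloser-≥ {suc p} h (opener   ∷ w) (s≤s p≤q) (s≤s le) =
  closersW-insertCloser-≥ (suc h) w p≤q le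
closersW-insertCloser-≥ {suc p} h (closer c ∷ w) (s≤s p≤q) (s≤s le) =
  cong suc (closersW-insertCloser-≥ (pred h) w p≤q le)

closersW-insertCloser-≤ : ∀ {p q} h w → q ≤ p → closersW q (insertCloser p h w) ≡ closersW q w
closersW-insertCloser-≤ {p}     {zero}  h w              _         = refl
closersW-insertCloser-≤ {suc p} {suc q} h []             _         = refl
closersW-insertCloser-≤ {suc p} {suc q} h (opener ∷ w)   (s≤s q≤p) =
  closersW-insertCloser-≤ (suc h) w q≤p
closersW-insertCloser-≤ {suc p} {suc q} h (closer c ∷ w) (s≤s q≤p) =
  cong suc (closersW-insertCloser-≤ (pred h) w q≤p)

-- Every step adds one to the left side: behind an opener the carried closer has one more open arc
-- around it, and an exchange of closers keeps the nestings but puts one more closer among the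
-- letters counted. The remaining unit is the carried closer itself. `l` is arbitrary because
-- trading labels lowers it on the way.
nestingsW-rotate-closer : ∀ k {h l v} → Labelled h (closer l ∷ v) → k ≤ length v →
  let w = rotate k h (closer l ∷ v) in
  nestingsW h w + closersW (suc k) w ≡ nestingsW h (closer l ∷ v) + suc k
nestingsW-rotate-closer zero V le = refl
nestingsW-rotate-closer (suc k) {suc h} {l} {opener ∷ v} (closer∷ l≤h (opener∷ V)) (s≤s le) = begin
  nestingsW (suc (suc h)) w + closersW (suc k) w
    ≡⟨ nestingsW-rotate-closer k (closer∷ (m≤n⇒m≤1+n l≤h) V) le ⟩
  (suc h ∸ l) + nestingsW (suc h) v + suc k
    ≡⟨ cong (λ x → x + nestingsW (suc h) v + suc k) (+-∸-assoc 1 l≤h) ⟩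
  suc ((h ∸ l) + nestingsW (suc h) v + suc k)
    ≡⟨ +-suc (h ∸ l + nestingsW (suc h) v) (suc k) ⟨
  (h ∸ l) + nestingsW (suc h) v + suc (suc k) ∎
  where
  open ≡-Reasoning
  w = rotate k (suc (suc h)) (closer l ∷ v)
nestingsW-rotate-closer (suc k) {suc (suc h)} {l} {closer c ∷ v} (closer∷ l≤1+h (closer∷ c≤h V)) (s≤s le)
  with l + c <? suc h
... | yes (s≤s l+c≤h) = begin
  (suc h ∸ c) + nestingsW (suc h) w + suc (closersW (suc k) w)
    ≡⟨ assoc (suc h ∸ c) (nestingsW (suc h) w) (closersW (suc k) w) ⟩
  (suc h ∸ c) + suc (nestingsW (suc h) w + closersW (suc k) w)
    ≡⟨ cong₂ (λ x y → x + suc y) (+-∸-assoc 1 c≤h) (nestingsW-rotate-closer k (closer∷ l≤h V) le) ⟩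
  suc (h ∸ c) + suc ((h ∸ l) + nestingsW h v + suc k)
    ≡⟨ exchange (h ∸ c) (h ∸ l) (nestingsW h v) (suc k) ⟩
  suc (h ∸ l) + ((h ∸ c) + nestingsW h v) + suc (suc k)
    ≡⟨ cong (λ x → x + ((h ∸ c) + nestingsW h v) + suc (suc k)) (+-∸-assoc 1 l≤h) ⟨
  (suc h ∸ l) + ((h ∸ c) + nestingsW h v) + suc (suc k) ∎
  where
  open ≡-Reasoning
  w = rotate k (suc h) (closer l ∷ v)
  l≤h = m+n≤o⇒m≤o l l+c≤h
  assoc : ∀ a b d → a + b + suc d ≡ a + suc (b + d)
  assoc = solve-∀
  exchange : ∀ a b d e → suc a + suc (b + d + e) ≡ suc b + (a + d) + suc e
  exchange = solve-∀
nestingsW-rotate-closer (suc k) {suc (suc h)} {zero} {closer c ∷ v} (closer∷ _ (closer∷ c≤h V)) (s≤s le)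
  | no l+c≮h = ⊥-elim (l+c≮h (s≤s c≤h))
nestingsW-rotate-closer (suc k) {suc (suc h)} {suc l} {closer c ∷ v} (closer∷ (s≤s l≤h) (closer∷ c≤h V)) (s≤s le)
  | no _ = begin
  (h ∸ c) + nestingsW (suc h) w + suc (closersW (suc k) w)
    ≡⟨ assoc (h ∸ c) (nestingsW (suc h) w) (closersW (suc k) w) ⟩
  (h ∸ c) + suc (nestingsW (suc h) w + closersW (suc k) w)
    ≡⟨ cong (λ y → (h ∸ c) + suc y) (nestingsW-rotate-closer k (closer∷ l≤h V) le) ⟩
  (h ∸ c) + suc ((h ∸ l) + nestingsW h v + suc k)
    ≡⟨ exchange (h ∸ c) (h ∸ l) (nestingsW h v) (suc k) ⟩
  (h ∸ l) + ((h ∸ c) + nestingsW h v) + suc (suc k) ∎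
  where
  open ≡-Reasoning
  w = rotate k (suc h) (closer l ∷ v)
  assoc : ∀ a b d → a + b + suc d ≡ a + suc (b + d)
  assoc = solve-∀
  exchange : ∀ a b d e → a + suc (b + d + e) ≡ b + (a + d) + suc e
  exchange = solve-∀

-- Passing an opener changes nothing; a passed closer loses one nesting but joins the closers
-- counted. So the left side is constant for `b` steps, and the gain starts only with the inserted
-- closer.
nestingsW-rotate-opener : ∀ k b {h v} → Labelled h v → b ≤ length v → k ≤ suc (length v) →
  let w = rotate k h (opener ∷ insertCloser b h v) in
  nestingsW h w + closersW (suc k) w ≡ nestingsW (suc h) (insertCloser b h v) + (k ∸ b)
nestingsW-rotate-opener zero b {h} {v} V b≤ k≤ =
  cong (nestingsW (suc h) (insertCloser b h v) +_) (sym (0∸n≡0 b))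
-- The inserted closer has label `h`, so this swap leaves the pair alone and the closer is carried
-- from here on.
nestingsW-rotate-opener (suc k) zero {h} {v} V b≤ (s≤s k≤) with h <? h
... | yes h<h = ⊥-elim (<-irrefl refl h<h)
nestingsW-rotate-opener (suc zero) zero V b≤ k≤ | no _ = refl
nestingsW-rotate-opener (suc (suc k)) zero V b≤ (s≤s k≤) | no _ =
  nestingsW-rotate-closer (suc k) (closer∷ ≤-refl V) k≤
nestingsW-rotate-opener (suc k) (suc b) (opener∷ V) (s≤s b≤) (s≤s k≤) =
  nestingsW-rotate-opener k b V b≤ k≤
nestingsW-rotate-opener (suc k) (suc b) {suc h} {closer c ∷ v} (closer∷ c≤h V) (s≤s b≤) (s≤s k≤)
  with c <? suc h
... | no c≮h = ⊥-elim (c≮h (s≤s c≤h))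
... | yes _ = begin
  (h ∸ c) + nestingsW h w + suc (closersW (suc k) w)
    ≡⟨ assoc (h ∸ c) (nestingsW h w) (closersW (suc k) w) ⟩
  suc (h ∸ c) + (nestingsW h w + closersW (suc k) w)
    ≡⟨ cong₂ _+_ (sym (+-∸-assoc 1 c≤h)) (nestingsW-rotate-opener k b V b≤ k≤) ⟩
  (suc h ∸ c) + (nestingsW (suc h) (insertCloser b h v) + (k ∸ b))
    ≡⟨ +-assoc (suc h ∸ c) _ _ ⟨
  (suc h ∸ c) + nestingsW (suc h) (insertCloser b h v) + (k ∸ b) ∎
  where
  open ≡-Reasoning
  w = rotate k h (opener ∷ insertCloser b h v)
  assoc : ∀ a b d → a + b + suc d ≡ suc a + (b + d)
  assoc = solve-∀

-- The head belongs to the last east step, or to the arc added last; the length of the tail is the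
-- number of steps or arcs before it.
data Bounded : List ℕ → Set where
  []  : Bounded []
  _∷_ : ∀ {a s} → a ≤ 2 * length s → Bounded s → Bounded (a ∷ s)

++-bounded : ∀ {s t} → Bounded s → Bounded t → Bounded (s ++ t)
++-bounded [] bt = bt
++-bounded {a ∷ s} {t} (a≤ ∷ bs) bt =
  ≤-trans a≤ (*-monoʳ-≤ 2 (subst (length s ≤_) (sym (length-++ s)) (m≤m+n _ _))) ∷ ++-bounded bs bt

2*-suc : ∀ n → 2 * suc n ≡ 2 + 2 * n
2*-suc n = *-suc 2 n

record IsWord (n : ℕ) (w : Word) : Set where
  constructor _,_
  field
    labelled : Labelled 0 w
    size     : length w ≡ 2 * n

-- Coding words by bounded lists

record Rearrangement : Set where
  field
    apply unapply : ℕ → Word → Word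
    apply-word    : ∀ a {n w} → IsWord n w → IsWord n (apply a w)
    unapply-word  : ∀ a {n w} → IsWord n w → IsWord n (unapply a w)
    unapply-apply : ∀ a {n w} → IsWord n w → unapply a (apply a w) ≡ w
    apply-unapply : ∀ a {n w} → IsWord n w → apply a (unapply a w) ≡ w
    apply-++      : ∀ a w w′ → a ≤ length w → apply a (w ++ w′) ≡ apply a w ++ w′

insertArc-word : ∀ {a n w} → IsWord n w → a ≤ 2 * n → IsWord (suc n) (insertArc a w)
insertArc-word {a} {n} {w} (V , eq) a≤ =
  opener∷ (insertCloser-labelled V a≤w) ,
  trans (cong suc (length-insertCloser a 0 w a≤w)) (trans (cong (2 +_) eq) (sym (2*-suc n)))
  where a≤w = subst (a ≤_) (sym eq) a≤

removeArc-insertArc : ∀ {a n w} → IsWord n w → a ≤ 2 * n → removeArc (insertArc a w) ≡ (a , w)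
removeArc-insertArc {a} (V , eq) a≤ = removeCloser-insertCloser V (subst (a ≤_) (sym eq) a≤)

removeArc-removed : ∀ {n w} → IsWord (suc n) w →
  let a , w′ = removeArc w in IsWord n w′ × a ≤ 2 * n × insertArc a w′ ≡ w
removeArc-removed {n} {_ ∷ w} (opener∷ V , eq)
  with removed V′ a≤ ins ← removeCloser-removed V =
  (V′ , eq′) , subst (proj₁ r ≤_) eq′ a≤ , cong (opener ∷_) ins
  where
  r = removeCloser 0 w
  open ≡-Reasoning
  eq′ = suc-injective (suc-injective (begin
    2 + length (proj₂ r) ≡⟨ cong suc (length-insertCloser (proj₁ r) 0 (proj₂ r) a≤) ⟨
    suc (length (insertCloser (proj₁ r) 0 (proj₂ r))) ≡⟨ cong (suc ∘ length) ins ⟩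
    suc (length w) ≡⟨ eq ⟩
    2 * suc n ≡⟨ 2*-suc n ⟩
    2 + 2 * n ∎))

-- Any reversible rearrangement before each insertion yields a bijection between bounded lists and
-- words. The identity gives the coding of matchings, the rotation that of paths.
module Coding (ρ : Rearrangement) where
  open Rearrangement ρ

  encode : List ℕ → Word
  encode []      = []
  encode (a ∷ s) = insertArc a (apply a (encode s))

  decode : ℕ → Word → List ℕ
  decode zero    w = []
  decode (suc n) w = let a , w′ = removeArc w in a ∷ decode n (unapply a w′)

  encode-word : ∀ {s} → Bounded s → IsWord (length s) (encode s)
  encode-word []            = [] , refl
  encode-word {a ∷ _} (a≤ ∷ bs) = insertArc-word (apply-word a (encode-word bs)) a≤

  decode-encode : ∀ {s} → Bounded s → decode (length s) (encode s) ≡ s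
  decode-encode [] = refl
  decode-encode {a ∷ s} (a≤ ∷ bs)
    rewrite removeArc-insertArc (apply-word a (encode-word bs)) a≤ =
    cong (a ∷_) (trans (cong (decode (length s)) (unapply-apply a (encode-word bs))) (decode-encode bs))

  length-decode : ∀ n w → length (decode n w) ≡ n
  length-decode zero    w = refl
  length-decode (suc n) w = cong suc (length-decode n _)

  decode-bounded : ∀ n {w} → IsWord n w → Bounded (decode n w)
  decode-bounded zero    W = []
  decode-bounded (suc n) {w} W with W′ , a≤ , _ ← removeArc-removed W =
    subst (λ m → proj₁ (removeArc w) ≤ 2 * m) (sym (length-decode n _)) a≤ ∷
    decode-bounded n (unapply-word _ W′)

  encode-decode : ∀ n {w} → IsWord n w → encode (decode n w) ≡ w
  encode-decode zero {[]} W = refl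
  encode-decode (suc n) {w} W with W′ , a≤ , eq ← removeArc-removed W =
    trans (cong (insertArc a) (trans (cong (apply a) (encode-decode n (unapply-word a W′)))
                                     (apply-unapply a W′)))
          eq
    where a = proj₁ (removeArc w)

  encode-injective : ∀ {s t} → Bounded s → Bounded t → length s ≡ length t →
                     encode s ≡ encode t → s ≡ t
  encode-injective {s} {t} bs bt len eq =
    trans (sym (decode-encode bs)) (trans (cong₂ decode len eq) (decode-encode bt))

  -- The bounds on `s` confine its rearrangements and insertions to the letters produced by `s`
  -- itself, in front of `encode t`.
  encode-++ : ∀ {s t} → Bounded s → encode (s ++ t) ≡ encode s ++ encode t
  encode-++ [] = refl
  encode-++ {a ∷ s} {t} (a≤ ∷ bs) = begin
    insertArc a (apply a (encode (s ++ t)))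
      ≡⟨ cong (insertArc a ∘ apply a) (encode-++ bs) ⟩
    insertArc a (apply a (encode s ++ encode t))
      ≡⟨ cong (insertArc a) (apply-++ a (encode s) (encode t) (fits W)) ⟩
    insertArc a (apply a (encode s) ++ encode t)
      ≡⟨ cong (opener ∷_) (insertCloser-++ a 0 _ (encode t) (fits (apply-word a W))) ⟩
    insertArc a (apply a (encode s)) ++ encode t ∎
    where
    open ≡-Reasoning
    W = encode-word bs
    fits : ∀ {w} → IsWord (length s) w → a ≤ length w
    fits (_ , eq) = subst (a ≤_) (sym eq) a≤

identity : Rearrangement
identity = record
  { apply = λ _ w → w ; unapply = λ _ w → w
  ; apply-word = λ _ W → W ; unapply-word = λ _ W → W
  ; unapply-apply = λ _ _ → refl ; apply-unapply = λ _ _ → refl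
  ; apply-++ = λ _ _ _ _ → refl
  }

-- `pred a` swaps read the first `a` letters, which are those that the new arc will span.
rotation : Rearrangement
rotation = record
  { apply = λ a → rotate (pred a) 0 ; unapply = λ a → unrotate (pred a) 0
  ; apply-word    = λ a {_} {w} (V , eq) → rotate-labelled (pred a) V , trans (length-rotate (pred a) 0 w) eq
  ; unapply-word  = λ a {_} {w} (V , eq) → unrotate-labelled (pred a) V , trans (length-unrotate (pred a) 0 w) eq
  ; unapply-apply = λ a (V , _) → unrotate-rotate (pred a) V
  ; apply-unapply = λ a (V , _) → rotate-unrotate (pred a) V
  ; apply-++      = rotation-++
  }
  where
  rotation-++ : ∀ a w w′ → a ≤ length w → rotate (pred a) 0 (w ++ w′) ≡ rotate (pred a) 0 w ++ w′
  rotation-++ zero    w w′ _  = refl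
  rotation-++ (suc k) w w′ le = rotate-++ k 0 w w′ le

module Arcs = Coding identity
module Path = Coding rotation

-- The change of coding: the heights of a path become the insertion positions of the matching with
-- the same word.
transform : List ℕ → List ℕ
transform s = Arcs.decode (length s) (Path.encode s)

length-transform : ∀ s → length (transform s) ≡ length s
length-transform s = Arcs.length-decode (length s) _

transform-bounded : ∀ {s} → Bounded s → Bounded (transform s)
transform-bounded bs = Arcs.decode-bounded _ (Path.encode-word bs)

encode-transform : ∀ {s} → Bounded s → Arcs.encode (transform s) ≡ Path.encode s
encode-transform bs = Arcs.encode-decode _ (Path.encode-word bs)

transform-++ : ∀ {s t} → Bounded s → Bounded t →
               transform (s ++ t) ≡ transform s ++ transform t
transform-++ {s} {t} bs bt = trans
  (cong₂ Arcs.decode lengths words)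
  (Arcs.decode-encode (++-bounded (transform-bounded bs) (transform-bounded bt)))
  where
  open ≡-Reasoning
  lengths = begin
    length (s ++ t) ≡⟨ length-++ s ⟩
    length s + length t ≡⟨ cong₂ _+_ (length-transform s) (length-transform t) ⟨
    length (transform s) + length (transform t) ≡⟨ length-++ (transform s) ⟨
    length (transform s ++ transform t) ∎
  words = begin
    Path.encode (s ++ t) ≡⟨ Path.encode-++ bs ⟩
    Path.encode s ++ Path.encode t ≡⟨ cong₂ _++_ (encode-transform bs) (encode-transform bt) ⟨
    Arcs.encode (transform s) ++ Arcs.encode (transform t) ≡⟨ Arcs.encode-++ (transform-bounded bs) ⟨
    Arcs.encode (transform s ++ transform t) ∎

transform-injective : ∀ {s t} → Bounded s → Bounded t → length s ≡ length t →
                      transform s ≡ transform t → s ≡ t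
transform-injective bs bt len eq = Path.encode-injective bs bt len
  (trans (sym (encode-transform bs)) (trans (cong Arcs.encode eq) (encode-transform bt)))

transform-surjective : ∀ {t} → Bounded t → ∃ λ s → Bounded s × length s ≡ length t × transform s ≡ t
transform-surjective {t} bt = s , bs , len ,
  trans (cong₂ Arcs.decode len (Path.encode-decode (length t) W)) (Arcs.decode-encode bt)
  where
  W   = Arcs.encode-word bt
  s   = Path.decode (length t) (Arcs.encode t)
  bs  = Path.decode-bounded (length t) W
  len = Path.length-decode (length t) (Arcs.encode t)

-- Rearranging happens before the insertion, so in both codings the head alone places the closer of
-- the leftmost arc. This links the last descent to the partner of 1.
transform-∷ : ∀ {a s} → Bounded (a ∷ s) → ∃ λ t → transform (a ∷ s) ≡ a ∷ t
transform-∷ {a} (a≤ ∷ bs)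
  rewrite removeArc-insertArc (Rearrangement.apply-word rotation a (Path.encode-word bs)) a≤ = _ , refl

-- The height at which the vertical run to the next east step starts: an east step moves one unit
-- further from `y = - x`, and the walk itself starts on it.
top : List ℕ → ℕ
top []      = 0
top (a ∷ _) = suc a

rises : List ℕ → ℕ
rises []      = 0
rises (a ∷ s) = rises s + (a ∸ top s)

nestingsW-encode : ∀ {s} → Bounded s → nestingsW 0 (Path.encode s) ≡ rises s
nestingsW-encode [] = refl
nestingsW-encode {a ∷ s} (a≤ ∷ bs) with Path.encode-word bs | Rearrangement.apply-word rotation a (Path.encode-word bs)
... | W | V , eq = begin
  nestingsW 1 (insertCloser a 0 w)
    ≡⟨ nestingsW-insertCloser V (subst (a ≤_) (sym eq) a≤) ⟩
  nestingsW 0 w + closersW a w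
    ≡⟨ rotation-nestings a≤ bs ⟩
  nestingsW 0 (Path.encode s) + (a ∸ top s)
    ≡⟨ cong (_+ (a ∸ top s)) (nestingsW-encode bs) ⟩
  rises s + (a ∸ top s) ∎
  where
  open ≡-Reasoning
  w = rotate (pred a) 0 (Path.encode s)
  rotation-nestings : ∀ {a s} → a ≤ 2 * length s → Bounded s →
    let w = rotate (pred a) 0 (Path.encode s) in
    nestingsW 0 w + closersW a w ≡ nestingsW 0 (Path.encode s) + (a ∸ top s)
  rotation-nestings {zero}  {s}     _  _           =
    cong (nestingsW 0 (Path.encode s) +_) (sym (0∸n≡0 (top s)))
  -- `top (b ∷ s)` is `suc b`, so `suc k ∸ suc b` computes to the `k ∸ b` of
  -- `nestingsW-rotate-opener`.
  rotation-nestings {suc k} {b ∷ s} k≤ (b≤ ∷ bs)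
    with V , eq ← Rearrangement.apply-word rotation b (Path.encode-word bs) =
    nestingsW-rotate-opener k b V (subst (b ≤_) (sym eq) b≤)
      (subst (λ m → k ≤ suc m) (sym eq) (≤-pred (subst (suc k ≤_) (2*-suc (length s)) k≤)))

PreservesCrossings : Rearrangement → Set
PreservesCrossings ρ = ∀ a {n w} → IsWord n w → crossingsW (Rearrangement.apply ρ a w) ≡ crossingsW w

-- An insertion adds `heightW` crossings, which fall short of `a` by twice the closers spanned. The
-- witness accumulates these closers.
encode-crossings : ∀ ρ → PreservesCrossings ρ → ∀ {s} → Bounded s →
                   ∃ λ c → crossingsW (Coding.encode ρ s) + c * 2 ≡ sum s
encode-crossings ρ preserve [] = 0 , refl
encode-crossings ρ preserve {a ∷ s} (a≤ ∷ bs)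
  with V , len ← Rearrangement.apply-word ρ a (Coding.encode-word ρ bs)
  with c , eq ← encode-crossings ρ preserve bs = c + closersW a w , (begin
    crossingsW (insertCloser a 0 w) + (c + closersW a w) * 2
      ≡⟨ cong (_+ (c + closersW a w) * 2) (crossingsW-insertCloser a 0 w a≤w) ⟩
    crossingsW w + heightW a 0 w + (c + closersW a w) * 2
      ≡⟨ lemma (crossingsW w) (heightW a 0 w) c (closersW a w) ⟩
    (heightW a 0 w + 2 * closersW a w) + (crossingsW w + c * 2)
      ≡⟨ cong₂ _+_ (heightW-closersW V a≤w)
           (trans (cong (_+ c * 2) (preserve a (Coding.encode-word ρ bs))) eq) ⟩
    a + sum s ∎)
  where
  open ≡-Reasoning
  w = Rearrangement.apply ρ a (Coding.encode ρ s)
  a≤w = subst (a ≤_) (sym len) a≤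
  lemma : ∀ x h c d → x + h + (c + d) * 2 ≡ (h + 2 * d) + (x + c * 2)
  lemma = solve-∀

encode-parity : ∀ ρ → PreservesCrossings ρ → ∀ {s} → Bounded s →
                crossingsW (Coding.encode ρ s) % 2 ≡ sum s % 2
encode-parity ρ preserve {s} bs with c , eq ← encode-crossings ρ preserve bs =
  trans (sym ([m+kn]%n≡m%n (crossingsW (Coding.encode ρ s)) c 2)) (cong (_% 2) eq)

-- Both lists code one word, and in either coding its crossings have the parity of the sum.
transform-parity : ∀ {s} → Bounded s → sum (transform s) % 2 ≡ sum s % 2
transform-parity {s} bs = begin
  sum (transform s) % 2                      ≡⟨ encode-parity identity (λ _ _ → refl) (transform-bounded bs) ⟨
  crossingsW (Arcs.encode (transform s)) % 2 ≡⟨ cong (λ w → crossingsW w % 2) (encode-transform bs) ⟩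
  crossingsW (Path.encode s) % 2
    ≡⟨ encode-parity rotation (λ a W → crossingsW-rotate (pred a) (IsWord.labelled W)) bs ⟩
  sum s % 2                                  ∎
  where open ≡-Reasoning

-- Matchings built by adding leftmost arcs

-- The order embedding of {1 , 2 , …} onto its complement {2 , 3 , …} ∖ {p + 2}.
gap : ℕ → ℕ → ℕ
gap p       zero    = 1
gap zero    (suc x) = 3 + x
gap (suc p) (suc x) = suc (gap p x)

gap-≤ : ∀ {p x} → x ≤ p → gap p x ≡ suc x
gap-≤ {p} {zero} _ = refl
gap-≤ (s≤s x≤p)    = cong suc (gap-≤ x≤p)

gap-> : ∀ {p x} → p < x → gap p x ≡ 2 + x
gap-> {zero}  {suc x} _         = refl
gap-> {suc p} {suc x} (s≤s p<x) = cong suc (gap-> p<x)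

suc≤gap : ∀ p x → suc x ≤ gap p x
suc≤gap p       zero    = ≤-refl
suc≤gap zero    (suc x) = n≤1+n _
suc≤gap (suc p) (suc x) = s≤s (suc≤gap p x)

gap-mono-< : ∀ p {x y} → x < y → gap p x < gap p y
gap-mono-< zero    {zero}  (s≤s z≤n)       = s≤s (s≤s z≤n)
gap-mono-< (suc p) {zero} {suc y} _        = s≤s (≤-trans (s≤s z≤n) (suc≤gap p y))
gap-mono-< zero    {suc x} (s≤s x<y)       = s≤s (s≤s (s≤s x<y))
gap-mono-< (suc p) {suc x} (s≤s x<y)       = s≤s (gap-mono-< p x<y)

gap-cancel-< : ∀ p {x y} → gap p x < gap p y → x < y
gap-cancel-< p {x} {y} lt with <-cmp x y
... | tri< x<y _ _    = x<y
... | tri≈ _ refl _   = ⊥-elim (<-irrefl refl lt)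
... | tri> _ _ y<x    = ⊥-elim (<-asym lt (gap-mono-< p y<x))

gap-injective : ∀ p {x y} → gap p x ≡ gap p y → x ≡ y
gap-injective p {x} {y} eq with <-cmp x y
... | tri< x<y _ _  = ⊥-elim (<-irrefl eq (gap-mono-< p x<y))
... | tri≈ _ x≡y _  = x≡y
... | tri> _ _ y<x  = ⊥-elim (<-irrefl (sym eq) (gap-mono-< p y<x))

-- Past the inserted closer both new points precede the threshold, before it only the new 1 does;
-- hence `2 + q` here and `suc q` in `gap-<-threshold`.
gap-≤-threshold : ∀ {p q} x → p ≤ q → gap p x ≤ 2 + q ⇔ x ≤ q
gap-≤-threshold {p} {q} x p≤q with x ≤? p
... | yes x≤p rewrite gap-≤ x≤p =
  mk⇔ (λ _ → ≤-trans x≤p p≤q) (λ x≤q → s≤s (m≤n⇒m≤1+n x≤q))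
... | no x≰p rewrite gap-> (≰⇒> x≰p) = mk⇔ (≤-pred ∘ ≤-pred) (s≤s ∘ s≤s)

gap-<-threshold : ∀ {p q} x → q ≤ p → gap p x ≤ suc q ⇔ x ≤ q
gap-<-threshold {p} {q} x q≤p with x ≤? p
... | yes x≤p rewrite gap-≤ x≤p = mk⇔ ≤-pred s≤s
... | no x≰p rewrite gap-> (≰⇒> x≰p) =
  mk⇔ (λ lt → ≤-trans (n≤1+n x) (≤-pred lt)) (λ x≤q → ⊥-elim (x≰p (≤-trans x≤q q≤p)))

gapBlock : ℕ → Block → Block
gapBlock p (i , j) = gap p i , gap p j

blocks : List ℕ → List Block
blocks []      = []
blocks (p ∷ s) = (1 , 2 + p) ∷ map (gapBlock p) (blocks s)

Ordered Positive : Block → Set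
Ordered  (i , j) = i < j
Positive (i , j) = 0 < i

Increasing : Block → Block → Set
Increasing p q = proj₁ p < proj₁ q

blocks-ordered : ∀ s → All Ordered (blocks s)
blocks-ordered []      = []
blocks-ordered (p ∷ s) = s≤s (s≤s z≤n) ∷ All.map⁺ (All.map (gap-mono-< p) (blocks-ordered s))

blocks-positive : ∀ s → All Positive (blocks s)
blocks-positive []      = []
blocks-positive (p ∷ s) =
  s≤s z≤n ∷ All.map⁺ (All.map (λ {b} _ → ≤-trans (s≤s z≤n) (suc≤gap p (proj₁ b))) (blocks-positive s))

linked-∷ : ∀ {b bs} → All (Increasing b) bs → Linked Increasing bs → Linked Increasing (b ∷ bs)
linked-∷ []      _ = [-]
linked-∷ (r ∷ _) l = r ∷ l

blocks-sorted : ∀ s → Linked Increasing (blocks s)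
blocks-sorted []      = []
blocks-sorted (p ∷ s) = linked-∷
  (All.map⁺ (All.map (λ {b} 0<i → ≤-trans (s≤s 0<i) (suc≤gap p (proj₁ b))) (blocks-positive s)))
  (Linked.map⁺ (Linked.map (gap-mono-< p) (blocks-sorted s)))

elements : List Block → List ℕ
elements = concatMap (λ (i , j) → i ∷ j ∷ [])

elements-map : ∀ (f : ℕ → ℕ) bs → elements (map (λ (i , j) → f i , f j) bs) ≡ map f (elements bs)
elements-map f []             = refl
elements-map f ((i , j) ∷ bs) = cong (λ l → f i ∷ f j ∷ l) (elements-map f bs)

interval : ℕ → List ℕ
interval m = map suc (upTo m)

applyUpTo-cong : ∀ {f g : ℕ → ℕ} m → (∀ i → f i ≡ g i) → applyUpTo f m ≡ applyUpTo g m
applyUpTo-cong zero    eq = refl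
applyUpTo-cong (suc m) eq = cong₂ _∷_ (eq 0) (applyUpTo-cong m (eq ∘ suc))

-- The hypotheses say that `f` runs through the values of `g` with `g p` skipped.
applyUpTo-insert : ∀ {p m} {f g : ℕ → ℕ} → p ≤ m →
                   (∀ {i} → i < p → f i ≡ g i) → (∀ {i} → p ≤ i → f i ≡ g (suc i)) →
                   g p ∷ applyUpTo f m ↭ applyUpTo g (suc m)
applyUpTo-insert {zero} {m} {g = g} _ _ above =
  prep (g 0) (↭-reflexive (applyUpTo-cong m λ _ → above z≤n))
applyUpTo-insert {suc p} {suc m} {f} {g} (s≤s p≤m) below above = begin
  g (suc p) ∷ f 0 ∷ applyUpTo (f ∘ suc) m ↭⟨ Perm.swap _ _ ↭-refl ⟩
  f 0 ∷ g (suc p) ∷ applyUpTo (f ∘ suc) m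
    ≡⟨ cong (_∷ g (suc p) ∷ applyUpTo (f ∘ suc) m) (below (s≤s z≤n)) ⟩
  g 0 ∷ g (suc p) ∷ applyUpTo (f ∘ suc) m
    ↭⟨ prep (g 0) (applyUpTo-insert p≤m (below ∘ s≤s) (above ∘ s≤s)) ⟩
  applyUpTo g (suc (suc m)) ∎
  where open Perm.PermutationReasoning

gap-partition : ∀ {p m} → p ≤ m → 1 ∷ 2 + p ∷ map (gap p) (interval m) ↭ interval (2 + m)
gap-partition {p} {m} p≤m = prep 1 (begin
  2 + p ∷ map (gap p) (interval m)  ≡⟨ cong (λ l → 2 + p ∷ map (gap p) l) (map-upTo suc m) ⟩
  2 + p ∷ map (gap p) (applyUpTo suc m) ≡⟨ cong (2 + p ∷_) (map-applyUpTo suc (gap p) m) ⟩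
  2 + p ∷ applyUpTo (gap p ∘ suc) m ↭⟨ applyUpTo-insert p≤m gap-≤ (gap-> ∘ s≤s) ⟩
  applyUpTo (2 +_) (suc m)          ≡⟨ map-applyUpTo suc suc (suc m) ⟨
  map suc (applyUpTo suc (suc m))   ∎)
  where open Perm.PermutationReasoning

blocks-partition : ∀ {s} → Bounded s → elements (blocks s) ↭ interval (2 * length s)
blocks-partition []                   = ↭-refl
blocks-partition {p ∷ s} (p≤ ∷ bs) = begin
  1 ∷ 2 + p ∷ elements (map (gapBlock p) (blocks s)) ≡⟨ cong (λ l → 1 ∷ 2 + p ∷ l) (elements-map (gap p) (blocks s)) ⟩
  1 ∷ 2 + p ∷ map (gap p) (elements (blocks s))      ↭⟨ prep _ (prep _ (↭-map⁺ (gap p) (blocks-partition bs))) ⟩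
  1 ∷ 2 + p ∷ map (gap p) (interval (2 * length s))  ↭⟨ gap-partition p≤ ⟩
  interval (2 + 2 * length s)                        ≡⟨ cong interval (2*-suc (length s)) ⟨
  interval (2 * suc (length s))                      ∎
  where open Perm.PermutationReasoning

gapBlock-injective : ∀ p {b c} → gapBlock p b ≡ gapBlock p c → b ≡ c
gapBlock-injective p eq = cong₂ _,_ (gap-injective p (cong proj₁ eq)) (gap-injective p (cong proj₂ eq))

blocks-injective : ∀ {s t} → blocks s ≡ blocks t → s ≡ t
blocks-injective {[]}    {[]}    _  = refl
blocks-injective {p ∷ s} {q ∷ t} eq
  with refl ← suc-injective (suc-injective (cong proj₂ (proj₁ (∷-injective eq)))) =
  cong (p ∷_) (blocks-injective (map-injective (gapBlock-injective p) (proj₂ (∷-injective eq))))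

∈-interval⁻ : ∀ {x m} → x ∈ interval m → 0 < x × x ≤ m
∈-interval⁻ x∈ with i , i∈ , refl ← ∈-map⁻ suc x∈ = s≤s z≤n , ∈-upTo⁻ i∈

∈-elements₁ : ∀ {b bs} → b ∈ bs → proj₁ b ∈ elements bs
∈-elements₁ (here refl) = here refl
∈-elements₁ (there b∈)  = there (there (∈-elements₁ b∈))

∈-elements₂ : ∀ {b bs} → b ∈ bs → proj₂ b ∈ elements bs
∈-elements₂ (here refl) = there (here refl)
∈-elements₂ (there b∈)  = there (there (∈-elements₂ b∈))

∈-elements⁻ : ∀ {x} bs → x ∈ elements bs → ∃ λ b → b ∈ bs × (x ≡ proj₁ b ⊎ x ≡ proj₂ b)
∈-elements⁻ (b ∷ bs) (here refl)         = b , here refl , inj₁ refl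
∈-elements⁻ (b ∷ bs) (there (here refl)) = b , here refl , inj₂ refl
∈-elements⁻ (b ∷ bs) (there (there x∈)) with c , c∈ , eq ← ∈-elements⁻ bs x∈ = c , there c∈ , eq

head-minimal : ∀ {b c bs} → Linked Increasing (b ∷ bs) → c ∈ b ∷ bs → proj₁ b ≤ proj₁ c
head-minimal l (here refl) = ≤-refl
head-minimal {b} {c} (r ∷ l) (there c∈) =
  <⇒≤ (All.lookup (Linked.Linked⇒All {R = Increasing} <-trans {v = b} r l) c∈)

head≡1 : ∀ {m b bs} → All Ordered (b ∷ bs) → Linked Increasing (b ∷ bs) →
         elements (b ∷ bs) ↭ interval (suc m) → proj₁ b ≡ 1
head≡1 {m} {b} {bs} ord sor per
  with c , c∈ , which ← ∈-elements⁻ (b ∷ bs) (∈-resp-↭ (↭-sym per) (here refl)) =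
  ≤-antisym (≤-trans (head-minimal sor c∈) (c≤1 which))
            (proj₁ (∈-interval⁻ (∈-resp-↭ per (here refl))))
  where
  c≤1 : 1 ≡ proj₁ c ⊎ 1 ≡ proj₂ c → proj₁ c ≤ 1
  c≤1 (inj₁ eq) = ≤-reflexive (sym eq)
  c≤1 (inj₂ eq) = <⇒≤ (subst (proj₁ c <_) (sym eq) (All.lookup ord c∈))

ungap : ℕ → ℕ → ℕ
ungap p x with x ≤? suc p
... | yes _ = pred x
... | no  _ = pred (pred x)

ungap-gap : ∀ p x → ungap p (gap p x) ≡ x
ungap-gap p x with x ≤? p
... | yes x≤p rewrite gap-≤ x≤p with suc x ≤? suc p
...   | yes _  = refl
...   | no 1+x≰1+p = ⊥-elim (1+x≰1+p (s≤s x≤p))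
ungap-gap p x | no x≰p rewrite gap-> (≰⇒> x≰p) with 2 + x ≤? suc p
...   | yes 2+x≤1+p = ⊥-elim (x≰p (≤-trans (n≤1+n x) (≤-pred 2+x≤1+p)))
...   | no _ = refl

map-gap-image : ∀ {p m} bs → (∀ {x} → x ∈ elements bs → x ∈ map (gap p) (interval m)) →
                ∃ λ cs → bs ≡ map (gapBlock p) cs
map-gap-image []             _  = [] , refl
map-gap-image ((i , j) ∷ bs) im
  with i′ , _ , refl ← ∈-map⁻ _ (im (here refl))
     | j′ , _ , refl ← ∈-map⁻ _ (im (there (here refl)))
     | cs , refl     ← map-gap-image bs (im ∘ there ∘ there) = (i′ , j′) ∷ cs , refl

ungap-partition : ∀ {p m} cs → elements (map (gapBlock p) cs) ↭ map (gap p) (interval m) →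
                  elements cs ↭ interval m
ungap-partition {p} {m} cs per = begin
  elements cs                                      ≡⟨ ungap-map (elements cs) ⟨
  map (ungap p) (map (gap p) (elements cs))        ≡⟨ cong (map (ungap p)) (elements-map (gap p) cs) ⟨
  map (ungap p) (elements (map (gapBlock p) cs))   ↭⟨ ↭-map⁺ (ungap p) per ⟩
  map (ungap p) (map (gap p) (interval m))         ≡⟨ ungap-map (interval m) ⟩
  interval m                                       ∎
  where
  open Perm.PermutationReasoning
  ungap-map : ∀ xs → map (ungap p) (map (gap p) xs) ≡ xs
  ungap-map xs = trans (sym (map-∘ xs)) (trans (map-cong (ungap-gap p) xs) (map-id xs))

-- Sorting puts the block of 1 first, and its partner determines `p`. The other blocks avoid both
-- points, so they are pulled back along `gap p`.
blocks-surjective : ∀ n bs → All Ordered bs → Linked Increasing bs → elements bs ↭ interval (2 * n) →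
                    ∃ λ s → Bounded s × length s ≡ n × blocks s ≡ bs
blocks-surjective zero    []       _   _   _   = [] , [] , refl , refl
blocks-surjective zero    (b ∷ bs) _   _   per with () ← ↭-empty-inv per
blocks-surjective (suc n) []       _   _   per with () ← ↭-empty-inv (↭-sym per)
blocks-surjective (suc n) (b@(i , j) ∷ bs) ord@(i<j ∷ ord′) sor per
  with per′ ← subst (λ m → elements (b ∷ bs) ↭ interval m) (2*-suc n) per
  with refl ← head≡1 ord sor per′
  with p , refl ← m≤n⇒∃[o]m+o≡n i<j
  with s≤s (s≤s p≤) ← proj₂ (∈-interval⁻ (∈-resp-↭ per′ (there (here refl))))
  -- Without 1 and its partner, the remaining elements are the `gap p`-image of a full interval.
  with rest ← drop-∷ (drop-∷ (↭-trans per′ (↭-sym (gap-partition p≤))))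
  with cs , refl ← map-gap-image bs (∈-resp-↭ rest)
  with s , bs′ , refl , refl ← blocks-surjective n cs
         (All.map (gap-cancel-< p) (All.map⁻ ord′))
         (Linked.map (gap-cancel-< p) (Linked.map⁻ (Linked.tail sor)))
         (ungap-partition cs rest)
  = p ∷ s , p≤ ∷ bs′ , refl , refl

-- Counting crossings and nestings arc by arc

module _ {a b p q} {A : Set a} {B : Set b} {P : Pred A p} {Q : Pred B q}
         (P? : Decidable P) (Q? : Decidable Q) where

  count-map : ∀ (f : B → A) xs → All (λ x → P (f x) ⇔ Q x) xs →
              length (filter P? (map f xs)) ≡ length (filter Q? xs)
  count-map f []       _           = refl
  count-map f (x ∷ xs) (p⇔q ∷ all) with P? (f x) | Q? x
  ... | yes _ | yes _ = cong suc (count-map f xs all)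
  ... | no _  | no _  = count-map f xs all
  ... | yes p | no ¬q = ⊥-elim (¬q (Equivalence.to p⇔q p))
  ... | no ¬p | yes q = ⊥-elim (¬p (Equivalence.from p⇔q q))

module _ {p} {A : Set} {P : Pred (A × A) p} (P? : Decidable P) where

  count-pairs-∷ : ∀ x xs ys → length (filter P? (cartesianProduct (x ∷ xs) ys)) ≡
    length (filter P? (map (x ,_) ys)) + length (filter P? (cartesianProduct xs ys))
  count-pairs-∷ x xs ys = trans (cong length (filter-++ P? (map (x ,_) ys) _)) (length-++ (filter P? (map (x ,_) ys)))

  count-pairs-∷ʳ : ∀ xs y ys → All (λ x → ¬ P (x , y)) xs →
    length (filter P? (cartesianProduct xs (y ∷ ys))) ≡ length (filter P? (cartesianProduct xs ys))
  count-pairs-∷ʳ []       y ys []           = refl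
  count-pairs-∷ʳ (x ∷ xs) y ys (¬p ∷ all) = begin
    length (filter P? (cartesianProduct (x ∷ xs) (y ∷ ys)))
      ≡⟨ cong length (filter-reject P? ¬p) ⟩
    length (filter P? (map (x ,_) ys ++ cartesianProduct xs (y ∷ ys)))
      ≡⟨ trans (cong length (filter-++ P? (map (x ,_) ys) _)) (length-++ (filter P? (map (x ,_) ys))) ⟩
    length (filter P? (map (x ,_) ys)) + length (filter P? (cartesianProduct xs (y ∷ ys)))
      ≡⟨ cong (length (filter P? (map (x ,_) ys)) +_) (count-pairs-∷ʳ xs y ys all) ⟩
    length (filter P? (map (x ,_) ys)) + length (filter P? (cartesianProduct xs ys))
      ≡⟨ count-pairs-∷ x xs ys ⟨
    length (filter P? (cartesianProduct (x ∷ xs) ys)) ∎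
    where open ≡-Reasoning

  count-pairs-map : ∀ (f : A → A) → (∀ x y → P (f x , f y) ⇔ P (x , y)) → ∀ xs ys →
    length (filter P? (cartesianProduct (map f xs) (map f ys))) ≡ length (filter P? (cartesianProduct xs ys))
  count-pairs-map f eqv []       ys = refl
  count-pairs-map f eqv (x ∷ xs) ys = begin
    length (filter P? (cartesianProduct (map f (x ∷ xs)) (map f ys)))
      ≡⟨ count-pairs-∷ (f x) (map f xs) (map f ys) ⟩
    length (filter P? (map (f x ,_) (map f ys))) + length (filter P? (cartesianProduct (map f xs) (map f ys)))
      ≡⟨ cong₂ _+_ (cong (length ∘ filter P?) (trans (sym (map-∘ ys)) (map-∘ ys))) (count-pairs-map f eqv xs ys) ⟩
    length (filter P? (map g (map (x ,_) ys))) + length (filter P? (cartesianProduct xs ys))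
      ≡⟨ cong (_+ length (filter P? (cartesianProduct xs ys)))
           (count-map P? P? g (map (x ,_) ys) (All.universal (λ (u , v) → eqv u v) _)) ⟩
    length (filter P? (map (x ,_) ys)) + length (filter P? (cartesianProduct xs ys))
      ≡⟨ count-pairs-∷ x xs ys ⟨
    length (filter P? (cartesianProduct (x ∷ xs) ys)) ∎
    where
    open ≡-Reasoning
    g : A × A → A × A
    g (u , v) = f u , f v

closes? : ∀ q → Decidable {A = Block} (λ (_ , l) → l ≤ q)
closes? q (_ , l) = l ≤? q

straddles? : ∀ q → Decidable {A = Block} (λ (k , l) → k ≤ q × q < l)
straddles? q (k , l) = k ≤? q ×-dec q <? l

-- The closers among the first `q` points and the arcs still open after them: the counterparts of
-- `closersW` and `heightW`.
closing straddling : ℕ → List Block → ℕ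
closing    q bs = length (filter (closes? q) bs)
straddling q bs = length (filter (straddles? q) bs)

nestingPairs crossingPairs : List Block → ℕ
nestingPairs  bs = length (filter nests?   (cartesianProduct bs bs))
crossingPairs bs = length (filter crosses? (cartesianProduct bs bs))

module _ {P : Pred (Block × Block) 0ℓ} (P? : Decidable P)
         (later : ∀ {b c} → P (b , c) → proj₁ b < proj₁ c)
         (invariant : ∀ p b c → P (gapBlock p b , gapBlock p c) ⇔ P (b , c)) where

  -- The new block starts leftmost, so by `later` it is never the second of a pair; pairs of old
  -- blocks are unaffected because `gap p` preserves order.
  count-pairs-gap : ∀ p s →
    length (filter P? (cartesianProduct (blocks (p ∷ s)) (blocks (p ∷ s)))) ≡
    length (filter P? (map ((1 , 2 + p) ,_) (map (gapBlock p) (blocks s)))) +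
    length (filter P? (cartesianProduct (blocks s) (blocks s)))
  count-pairs-gap p s = begin
    length (filter P? (cartesianProduct (b ∷ bs) (b ∷ bs)))
      ≡⟨ count-pairs-∷ʳ P? (b ∷ bs) b bs
           ((λ pb → <-irrefl refl (later pb)) ∷
            All.map⁺ (All.universal (λ c pc → ≤⇒≯ (≤-trans (s≤s z≤n) (suc≤gap p (proj₁ c))) (later pc)) (blocks s))) ⟩
    length (filter P? (cartesianProduct (b ∷ bs) bs))
      ≡⟨ count-pairs-∷ P? b bs bs ⟩
    length (filter P? (map (b ,_) bs)) + length (filter P? (cartesianProduct bs bs))
      ≡⟨ cong (length (filter P? (map (b ,_) bs)) +_) (count-pairs-map P? (gapBlock p) (invariant p) (blocks s) (blocks s)) ⟩
    length (filter P? (map (b ,_) bs)) + length (filter P? (cartesianProduct (blocks s) (blocks s))) ∎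
    where
    open ≡-Reasoning
    b : Block
    b  = 1 , 2 + p
    bs = map (gapBlock p) (blocks s)

<-gap-⇔ : ∀ {p} x → 2 + p < gap p x ⇔ p < x
<-gap-⇔ {p} x with x ≤? p
... | yes x≤p rewrite gap-≤ x≤p =
  mk⇔ (λ lt → ⊥-elim (<-irrefl refl (≤-trans (≤-trans (n≤1+n _) (≤-pred lt)) x≤p)))
      (λ lt → ⊥-elim (<-irrefl refl (≤-trans lt x≤p)))
... | no x≰p rewrite gap-> (≰⇒> x≰p) = mk⇔ (≤-pred ∘ ≤-pred) (s≤s ∘ s≤s)

gap-<-⇔-≤ : ∀ {p} x → gap p x < 2 + p ⇔ x ≤ p
gap-<-⇔-≤ {p} x = mk⇔ (Equivalence.to (gap-<-threshold x ≤-refl) ∘ ≤-pred)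
                      (s≤s ∘ Equivalence.from (gap-<-threshold x ≤-refl))

nestingPairs-∷ : ∀ p s → nestingPairs (blocks (p ∷ s)) ≡ closing p (blocks s) + nestingPairs (blocks s)
nestingPairs-∷ p s = trans
  (count-pairs-gap nests? proj₁ invariant p s)
  (cong (_+ nestingPairs (blocks s)) (trans
    (cong (length ∘ filter nests?) (sym (map-∘ (blocks s))))
    (count-map nests? (closes? p) _ (blocks s) (All.zipWith enclosed (blocks-positive s , blocks-ordered s)))))
  where
  open Equivalence
  invariant : ∀ p b c → Nests (gapBlock p b , gapBlock p c) ⇔ Nests (b , c)
  invariant p _ _ = mk⇔ (λ (x , y , z) → gap-cancel-< p x , gap-cancel-< p y , gap-cancel-< p z)
                        (λ (x , y , z) → gap-mono-< p x , gap-mono-< p y , gap-mono-< p z)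
  enclosed : ∀ {b} → Positive b × Ordered b → Nests ((1 , 2 + p) , gapBlock p b) ⇔ proj₂ b ≤ p
  enclosed {i , j} (0<i , i<j) = mk⇔ (λ (_ , _ , lt) → to (gap-<-⇔-≤ j) lt)
    (λ le → ≤-trans (s≤s 0<i) (suc≤gap p i) , gap-mono-< p i<j , from (gap-<-⇔-≤ j) le)

crossingPairs-∷ : ∀ p s → crossingPairs (blocks (p ∷ s)) ≡ straddling p (blocks s) + crossingPairs (blocks s)
crossingPairs-∷ p s = trans
  (count-pairs-gap crosses? proj₁ invariant p s)
  (cong (_+ crossingPairs (blocks s)) (trans
    (cong (length ∘ filter crosses?) (sym (map-∘ (blocks s))))
    (count-map crosses? (straddles? p) _ (blocks s) (All.map crossed (blocks-positive s)))))
  where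
  open Equivalence
  invariant : ∀ p b c → Crosses (gapBlock p b , gapBlock p c) ⇔ Crosses (b , c)
  invariant p _ _ = mk⇔ (λ (x , y , z) → gap-cancel-< p x , gap-cancel-< p y , gap-cancel-< p z)
                        (λ (x , y , z) → gap-mono-< p x , gap-mono-< p y , gap-mono-< p z)
  crossed : ∀ {b} → Positive b → Crosses ((1 , 2 + p) , gapBlock p b) ⇔ (proj₁ b ≤ p × p < proj₂ b)
  crossed {i , j} 0<i = mk⇔ (λ (_ , x , y) → to (gap-<-⇔-≤ i) x , to (<-gap-⇔ j) y)
    (λ (x , y) → ≤-trans (s≤s 0<i) (suc≤gap p i) , from (gap-<-⇔-≤ i) x , from (<-gap-⇔ j) y)

closing-≥ : ∀ {p q} s → p ≤ q → closing (2 + q) (blocks (p ∷ s)) ≡ suc (closing q (blocks s))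
closing-≥ {p} {q} s p≤q = trans
  (cong length (filter-accept (closes? (2 + q)) (s≤s (s≤s p≤q))))
  (cong suc (count-map (closes? (2 + q)) (closes? q) (gapBlock p) (blocks s)
    (All.universal (λ (_ , l) → gap-≤-threshold l p≤q) _)))

closing-≤ : ∀ {p q} s → q ≤ p → closing (suc q) (blocks (p ∷ s)) ≡ closing q (blocks s)
closing-≤ {p} {q} s q≤p = trans
  (cong length (filter-reject (closes? (suc q)) (λ le → <-irrefl refl (≤-trans (≤-pred le) q≤p))))
  (count-map (closes? (suc q)) (closes? q) (gapBlock p) (blocks s)
    (All.universal (λ (_ , l) → gap-<-threshold l q≤p) _))

closing-0 : ∀ s → closing 0 (blocks s) ≡ 0
closing-0 s = cong length (filter-none (closes? 0)
  (All.map (λ i<j j≤0 → <-irrefl refl (≤-trans (≤-trans (s≤s z≤n) i<j) j≤0)) (blocks-ordered s)))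

<-⇔ : ∀ {x y q r} → x ≤ q ⇔ y ≤ r → q < x ⇔ r < y
<-⇔ eqv = mk⇔ (λ lt → ≰⇒> (λ le → ≤⇒≯ (Equivalence.from eqv le) lt))
              (λ lt → ≰⇒> (λ le → ≤⇒≯ (Equivalence.to eqv le) lt))

×-⇔ : ∀ {A B C D : Set} → A ⇔ B → C ⇔ D → (A × C) ⇔ (B × D)
×-⇔ f g = mk⇔ (λ (a , c) → Equivalence.to f a , Equivalence.to g c)
              (λ (b , d) → Equivalence.from f b , Equivalence.from g d)

straddling-≥ : ∀ {p q} s → p ≤ q → straddling (2 + q) (blocks (p ∷ s)) ≡ straddling q (blocks s)
straddling-≥ {p} {q} s p≤q = trans
  (cong length (filter-reject (straddles? (2 + q)) {x = 1 , 2 + p} {xs = map (gapBlock p) (blocks s)} (λ (_ , lt) → ≤⇒≯ (s≤s (s≤s p≤q)) lt)))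
  (count-map (straddles? (2 + q)) (straddles? q) (gapBlock p) (blocks s)
    (All.universal (λ (k , l) → ×-⇔ (gap-≤-threshold k p≤q) (<-⇔ (gap-≤-threshold l p≤q))) _))

straddling-≤ : ∀ {p q} s → q ≤ p → straddling (suc q) (blocks (p ∷ s)) ≡ suc (straddling q (blocks s))
straddling-≤ {p} {q} s q≤p = trans
  (cong length (filter-accept (straddles? (suc q)) (s≤s z≤n , s≤s (s≤s q≤p))))
  (cong suc (count-map (straddles? (suc q)) (straddles? q) (gapBlock p) (blocks s)
    (All.universal (λ (k , l) → ×-⇔ (gap-<-threshold k q≤p) (<-⇔ (gap-<-threshold l q≤p))) _)))

straddling-0 : ∀ s → straddling 0 (blocks s) ≡ 0
straddling-0 s = cong length (filter-none (straddles? 0)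
  (All.map (λ 0<i (i≤0 , _) → ≤⇒≯ i≤0 0<i) (blocks-positive s)))

closing-encode : ∀ {s} → Bounded s → ∀ q → closing q (blocks s) ≡ closersW q (Arcs.encode s)
closing-encode {s} bs zero = closing-0 s
closing-encode [] (suc q)  = refl
closing-encode {p ∷ s} (p≤ ∷ bs) (suc q) with q ≤? p
... | yes q≤p = trans (closing-≤ s q≤p)
  (trans (closing-encode bs q) (sym (closersW-insertCloser-≤ 0 (Arcs.encode s) q≤p)))
... | no q≰p with suc q ← q | s≤s p≤q ← ≰⇒> q≰p = trans (closing-≥ s p≤q)
  (trans (cong suc (closing-encode bs q)) (sym (closersW-insertCloser-≥ 0 (Arcs.encode s) p≤q
    (subst (p ≤_) (sym (IsWord.size (Arcs.encode-word bs))) p≤))))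

-- Each of the first `q` points is either the left end of an arc still open or one of the two ends
-- of an arc already closed.
straddling-closing : ∀ {s} → Bounded s → ∀ {q} → q ≤ 2 * length s →
                     straddling q (blocks s) + closing q (blocks s) * 2 ≡ q
straddling-closing {s} bs {zero} _ rewrite straddling-0 s | closing-0 s = refl
straddling-closing {p ∷ s} (p≤ ∷ bs) {suc q} q< with q ≤? p
... | yes q≤p rewrite straddling-≤ s q≤p | closing-≤ s q≤p =
  cong suc (straddling-closing bs (≤-trans q≤p p≤))
... | no q≰p with suc q ← q | s≤s p≤q ← ≰⇒> q≰p
  rewrite straddling-≥ s p≤q | closing-≥ s p≤q = begin
  straddling q (blocks s) + (2 + closing q (blocks s) * 2)
    ≡⟨ lemma (straddling q (blocks s)) (closing q (blocks s) * 2) ⟩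
  2 + (straddling q (blocks s) + closing q (blocks s) * 2)
    ≡⟨ cong (2 +_) (straddling-closing bs (≤-pred (≤-pred (subst (2 + q ≤_) (2*-suc (length s)) q<)))) ⟩
  2 + q ∎
  where
  open ≡-Reasoning
  lemma : ∀ a b → a + (2 + b) ≡ 2 + (a + b)
  lemma = solve-∀

nestings-encode : ∀ {s} → Bounded s → nestingPairs (blocks s) ≡ nestingsW 0 (Arcs.encode s)
nestings-encode [] = refl
nestings-encode {p ∷ s} (p≤ ∷ bs) with V , size ← Arcs.encode-word bs = begin
  nestingPairs (blocks (p ∷ s))                        ≡⟨ nestingPairs-∷ p s ⟩
  closing p (blocks s) + nestingPairs (blocks s)       ≡⟨ cong₂ _+_ (closing-encode bs p) (nestings-encode bs) ⟩
  closersW p w + nestingsW 0 w                         ≡⟨ +-comm (closersW p w) (nestingsW 0 w) ⟩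
  nestingsW 0 w + closersW p w                         ≡⟨ nestingsW-insertCloser V (subst (p ≤_) (sym size) p≤) ⟨
  nestingsW 0 (Arcs.encode (p ∷ s))                    ∎
  where
  open ≡-Reasoning
  w = Arcs.encode s

-- An insertion at `p` adds `straddling p` crossings and `closing p` nestings, which
-- `straddling-closing` weighs to `p`.
crossings-sum : ∀ {s} → Bounded s → crossingPairs (blocks s) + nestingPairs (blocks s) * 2 ≡ sum s
crossings-sum [] = refl
crossings-sum {p ∷ s} (p≤ ∷ bs) rewrite crossingPairs-∷ p s | nestingPairs-∷ p s = begin
  straddling p (blocks s) + x + (closing p (blocks s) + y) * 2
    ≡⟨ lemma (straddling p (blocks s)) x (closing p (blocks s)) y ⟩
  (straddling p (blocks s) + closing p (blocks s) * 2) + (x + y * 2)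
    ≡⟨ cong₂ _+_ (straddling-closing bs p≤) (crossings-sum bs) ⟩
  p + sum s ∎
  where
  open ≡-Reasoning
  x = crossingPairs (blocks s)
  y = nestingPairs (blocks s)
  lemma : ∀ a b c d → a + b + (c + d) * 2 ≡ (a + c * 2) + (b + d * 2)
  lemma = solve-∀

crossings-parity : ∀ {s} → Bounded s → crossingPairs (blocks s) % 2 ≡ sum s % 2
crossings-parity {s} bs =
  trans (sym ([m+kn]%n≡m%n (crossingPairs (blocks s)) (nestingPairs (blocks s)) 2))
        (cong (_% 2) (crossings-sum bs))

nestings-transform : ∀ {s} → Bounded s → nestingPairs (blocks (transform s)) ≡ rises s
nestings-transform bs = trans (nestings-encode (transform-bounded bs))
  (trans (cong (nestingsW 0) (encode-transform bs)) (nestingsW-encode bs))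

crossings-transform : ∀ {s} → Bounded s → crossingPairs (blocks (transform s)) % 2 ≡ sum s % 2
crossings-transform bs = trans (crossings-parity (transform-bounded bs)) (transform-parity bs)

blocks-head : ∀ {p s j} → (1 , j) ∈ blocks (p ∷ s) → j ≡ 2 + p
blocks-head (here refl) = refl
blocks-head {p} {s} (there b∈) with (i , _) , b∈s , eq ← ∈-map⁻ (gapBlock p) b∈ =
  ⊥-elim (<-irrefl (cong proj₁ eq) (≤-trans (s≤s (All.lookup (blocks-positive s) b∈s)) (suc≤gap p i)))

shiftBlock : ℕ → Block → Block
shiftBlock a (i , j) = a + i , a + j

gap-shift : ∀ {p} m x → p ≤ m → 0 < x → gap p (m + x) ≡ 2 + m + x
gap-shift m (suc x) p≤m _ = gap-> (≤-trans (s≤s (≤-trans p≤m (m≤m+n m x))) (≤-reflexive (sym (+-suc m x))))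

-- By the bounds, every arc of `s` is inserted entirely to the left of the blocks of `t` and pushes
-- them right by two.
blocks-++ : ∀ {s} t → Bounded s → blocks (s ++ t) ≡ blocks s ++ map (shiftBlock (2 * length s)) (blocks t)
blocks-++ t [] = sym (map-id _)
blocks-++ {p ∷ s} t (p≤ ∷ bs) = cong ((1 , 2 + p) ∷_) (begin
  map (gapBlock p) (blocks (s ++ t))
    ≡⟨ cong (map (gapBlock p)) (blocks-++ t bs) ⟩
  map (gapBlock p) (blocks s ++ map (shiftBlock m) (blocks t))
    ≡⟨ map-++ (gapBlock p) (blocks s) _ ⟩
  map (gapBlock p) (blocks s) ++ map (gapBlock p) (map (shiftBlock m) (blocks t))
    ≡⟨ cong (map (gapBlock p) (blocks s) ++_) (trans (sym (map-∘ (blocks t)))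
         (map-cong-local (All.zipWith shifted (blocks-positive t , blocks-ordered t)))) ⟩
  map (gapBlock p) (blocks s) ++ map (shiftBlock (2 * suc (length s))) (blocks t) ∎)
  where
  open ≡-Reasoning
  m = 2 * length s
  shifted : ∀ {b} → Positive b × Ordered b → gapBlock p (shiftBlock m b) ≡ shiftBlock (2 * suc (length s)) b
  shift : ∀ {x} → 0 < x → gap p (m + x) ≡ 2 * suc (length s) + x
  shift {x} 0<x = trans (gap-shift m x p≤ 0<x) (cong (_+ x) (sym (2*-suc (length s))))
  shifted (0<i , i<j) = cong₂ _,_ (shift 0<i) (shift (≤-trans 0<i (<⇒≤ i<j)))

gapBlock-closed : ∀ {p c} → p ≤ c → ∀ b → (proj₁ (gapBlock p b) ≤ 2 + c ⇔ proj₂ (gapBlock p b) ≤ 2 + c) →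
           proj₁ b ≤ c ⇔ proj₂ b ≤ c
gapBlock-closed p≤c (i , j) e = mk⇔
  (to (gap-≤-threshold j p≤c) ∘ to e ∘ from (gap-≤-threshold i p≤c))
  (to (gap-≤-threshold i p≤c) ∘ from e ∘ from (gap-≤-threshold j p≤c))
  where open Equivalence

-- Removing the leftmost arc from a closed set of initial points leaves one with two points fewer.
-- That this arc ends inside the set is precisely the bound that makes the prefix of the code
-- bounded.
closed-prefix : ∀ {s} → Bounded s → ∀ c → c ≤ 2 * length s →
                All (λ (i , j) → i ≤ c ⇔ j ≤ c) (blocks s) →
                ∃₂ λ u v → s ≡ u ++ v × Bounded u × 2 * length u ≡ c
closed-prefix bs zero _ _ = [] , _ , refl , [] , refl
closed-prefix {p ∷ s} (p≤ ∷ bs) (suc c) c< (e ∷ es)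
  -- The prefix contains 1, hence also its partner `2 + p`, so it has at least two points.
  with suc c ← c | s≤s (s≤s p≤c) ← Equivalence.to e (s≤s z≤n)
  with u , v , refl , bu , refl ← closed-prefix bs c (≤-pred (≤-pred (subst (2 + c ≤_) (2*-suc (length s)) c<)))
         (All.map (λ {b} → gapBlock-closed p≤c b) (All.map⁻ es)) =
  p ∷ u , v , refl , p≤c ∷ bu , 2*-suc (length u)

-- Opened only here because +_ makes the sections (m +_) above ambiguous.
open import Data.Integer using (+_)

-- Paths and the heights of their east steps

-- `d` is the height above `y = - x`. In these coordinates the wedge is `0 ≤ d ≤ 2 * x`, and an east
-- step raises both coordinates.
point : ℕ → ℕ → Point
point x d = + x , + d ℤ.- + x

move-east : ∀ x d → move east (point x d) ≡ point (suc x) (suc d)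
move-east x d = cong₂ _,_ (cong +_ (+-comm x 1)) (lemma (+ d) (+ x))
  where
  lemma : ∀ d x → d ℤ.- x ≡ (1ℤ ℤ.+ d) ℤ.- (1ℤ ℤ.+ x)
  lemma = ℤ-solve-∀

move-north : ∀ x d → move north (point x d) ≡ point x (suc d)
move-north x d = cong (+ x ,_) (lemma (+ d) (+ x))
  where
  lemma : ∀ d x → (d ℤ.- x) ℤ.+ 1ℤ ≡ (1ℤ ℤ.+ d) ℤ.- x
  lemma = ℤ-solve-∀

move-south : ∀ x d → move south (point x (suc d)) ≡ point x d
move-south x d = cong (+ x ,_) (lemma (+ d) (+ x))
  where
  lemma : ∀ d x → ((1ℤ ℤ.+ d) ℤ.- x) ℤ.- 1ℤ ≡ d ℤ.- x
  lemma = ℤ-solve-∀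

corner≡point : ∀ a → corner a ≡ point a 0
corner≡point a = cong (+ a ,_) (sym (ℤ.+-identityˡ (ℤ.- + a)))

point-injective : ∀ {x d x′ d′} → point x d ≡ point x′ d′ → x ≡ x′ × d ≡ d′
point-injective {x} {d} {x′} {d′} eq with refl ← ℤ.+-injective (cong proj₁ eq) =
  refl , ℤ.+-injective (trans (sym (lemma (+ d) (+ x))) (trans (cong (ℤ._+ + x) (cong proj₂ eq)) (lemma (+ d′) (+ x))))
  where
  lemma : ∀ d x → (d ℤ.- x) ℤ.+ x ≡ d
  lemma = ℤ-solve-∀

below-⇔ : ∀ a x d → WeaklyBelow a (point x d) ⇔ d + 2 * a ≤ 2 * x
below-⇔ a x d = mk⇔
  (λ le → ℤ.drop‿+≤+ (subst₂ ℤ._≤_ (lhs (+ d) (+ x) (+ (2 * a))) (rhs (+ x) (+ (2 * a)))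
            (ℤ.+-monoʳ-≤ (+ x ℤ.+ + (2 * a)) le)))
  (λ le → subst₂ ℤ._≤_ (lhs′ (+ d) (+ x) (+ (2 * a))) (rhs′ (+ x) (+ (2 * a)))
            (ℤ.+-monoʳ-≤ (ℤ.- (+ x ℤ.+ + (2 * a))) (ℤ.+≤+ le)))
  where
  lhs : ∀ d x a → (x ℤ.+ a) ℤ.+ (d ℤ.- x) ≡ d ℤ.+ a
  lhs = ℤ-solve-∀
  rhs : ∀ x a → (x ℤ.+ a) ℤ.+ (x ℤ.- a) ≡ x ℤ.+ (x ℤ.+ 0ℤ)
  rhs = ℤ-solve-∀
  lhs′ : ∀ d x a → ℤ.- (x ℤ.+ a) ℤ.+ (d ℤ.+ a) ≡ d ℤ.- x
  lhs′ = ℤ-solve-∀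
  rhs′ : ∀ x a → ℤ.- (x ℤ.+ a) ℤ.+ (x ℤ.+ (x ℤ.+ 0ℤ)) ≡ x ℤ.- a
  rhs′ = ℤ-solve-∀

wedge-⇔ : ∀ x d → InWedge (point x d) ⇔ d ≤ 2 * x
wedge-⇔ x d = mk⇔
  (λ (_ , le) → subst (_≤ 2 * x) (+-identityʳ d) (to (below-⇔ 0 x d) (subst (+ d ℤ.- + x ℤ.≤_) (sym (ℤ.+-identityʳ (+ x))) le)))
  (λ le → subst (ℤ._≤ + d ℤ.- + x) (ℤ.+-identityˡ (ℤ.- + x)) (ℤ.+-monoˡ-≤ (ℤ.- + x) (ℤ.+≤+ z≤n)) ,
          subst (+ d ℤ.- + x ℤ.≤_) (ℤ.+-identityʳ (+ x)) (from (below-⇔ 0 x d) (subst (_≤ 2 * x) (sym (+-identityʳ d)) le)))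
  where open Equivalence

south-leaves : ∀ x → ¬ InWedge (move south (point x 0))
south-leaves x (le , _) = absurd (subst₂ ℤ._≤_ (lhs (+ x)) (rhs (+ x)) (ℤ.+-monoˡ-≤ (+ x) le))
  where
  absurd : ¬ 0ℤ ℤ.≤ ℤ.-1ℤ
  absurd ()
  lhs : ∀ x → ℤ.- x ℤ.+ x ≡ 0ℤ
  lhs = ℤ-solve-∀
  rhs : ∀ x → ((0ℤ ℤ.- x) ℤ.- 1ℤ) ℤ.+ x ≡ ℤ.-1ℤ
  rhs = ℤ-solve-∀

antidiagonal⁻ : ∀ x d → OnAntidiagonal (point x d) → d ≡ 0
antidiagonal⁻ x d eq = proj₂ (point-injective {x} (cong (+ x ,_) (trans eq (sym (ℤ.+-identityˡ (ℤ.- + x))))))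

antidiagonal⁺ : ∀ x → OnAntidiagonal (point x 0)
antidiagonal⁺ x = ℤ.+-identityˡ (ℤ.- + x)

-- The wedge condition and the final height 0 as one induction on the walk. A natural number as
-- height builds in the lower wall.
data Stays : ℕ → ℕ → List Step → Set where
  []     : ∀ {x} → Stays x 0 []
  east∷  : ∀ {x d w} → d ≤ 2 * x → Stays (suc x) (suc d) w → Stays x d (east ∷ w)
  north∷ : ∀ {x d w} → d ≤ 2 * x → Stays x (suc d) w → Stays x d (north ∷ w)
  south∷ : ∀ {x d w} → suc d ≤ 2 * x → Stays x d w → Stays x (suc d) (south ∷ w)

stays⁺ : ∀ x d w → All InWedge (vertices (point x d) w) → OnAntidiagonal (endpoint (point x d) w) →
         Stays x d w
stays⁺ x d [] _ end rewrite antidiagonal⁻ x d end = []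
stays⁺ x d (east ∷ w) (i ∷ is) end rewrite move-east x d =
  east∷ (Equivalence.to (wedge-⇔ x d) i) (stays⁺ (suc x) (suc d) w is end)
stays⁺ x d (north ∷ w) (i ∷ is) end rewrite move-north x d =
  north∷ (Equivalence.to (wedge-⇔ x d) i) (stays⁺ x (suc d) w is end)
stays⁺ x zero (south ∷ w) (i ∷ is) end = ⊥-elim (south-leaves x (first w is))
  where
  first : ∀ {p} w → All InWedge (vertices p w) → InWedge p
  first []      (i ∷ _) = i
  first (_ ∷ _) (i ∷ _) = i
stays⁺ x (suc d) (south ∷ w) (i ∷ is) end rewrite move-south x d =
  south∷ (Equivalence.to (wedge-⇔ x (suc d)) i) (stays⁺ x d w is end)

stays-inWedge : ∀ {x d w} → Stays x d w → All InWedge (vertices (point x d) w)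
stays-inWedge {x} [] = Equivalence.from (wedge-⇔ x 0) z≤n ∷ []
stays-inWedge {x} {d} (east∷ {w = w} le s) = Equivalence.from (wedge-⇔ x d) le ∷
  subst (λ p → All InWedge (vertices p w)) (sym (move-east x d)) (stays-inWedge s)
stays-inWedge {x} {d} (north∷ {w = w} le s) = Equivalence.from (wedge-⇔ x d) le ∷
  subst (λ p → All InWedge (vertices p w)) (sym (move-north x d)) (stays-inWedge s)
stays-inWedge {x} {suc d} (south∷ {w = w} le s) = Equivalence.from (wedge-⇔ x (suc d)) le ∷
  subst (λ p → All InWedge (vertices p w)) (sym (move-south x d)) (stays-inWedge s)

offsets : ℕ → List Step → List ℕ
offsets d []          = []
offsets d (east  ∷ w) = d ∷ offsets (suc d) w
offsets d (north ∷ w) = offsets (suc d) w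
-- At height 0 this is a default value; `Stays` has no south step there.
offsets d (south ∷ w) = offsets (pred d) w

stays-endpoint : ∀ {x d w} → Stays x d w → endpoint (point x d) w ≡ point (x + length (offsets d w)) 0
stays-endpoint {x} [] = cong (λ y → point y 0) (sym (+-identityʳ x))
stays-endpoint {x} {d} (east∷ {w = w} _ s) rewrite move-east x d =
  trans (stays-endpoint s) (cong (λ y → point y 0) (sym (+-suc x _)))
stays-endpoint {x} {d} (north∷ _ s) rewrite move-north x d = stays-endpoint s
stays-endpoint {x} {suc d} (south∷ _ s) rewrite move-south x d = stays-endpoint s

eastPoints : ℕ → List ℕ → List Point
eastPoints x []       = []
eastPoints x (a ∷ as) = point x a ∷ eastPoints (suc x) as

stays-eastSteps : ∀ {x d w} → Stays x d w → eastSteps (point x d) w ≡ eastPoints x (offsets d w)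
stays-eastSteps [] = refl
stays-eastSteps {x} {d} (east∷ _ s) rewrite move-east x d = cong (point x d ∷_) (stays-eastSteps s)
stays-eastSteps {x} {d} (north∷ _ s) rewrite move-north x d = stays-eastSteps s
stays-eastSteps {x} {suc d} (south∷ _ s) rewrite move-south x d = stays-eastSteps s

record Split (x d : ℕ) (u v : List Step) : Set where
  field
    {height} : ℕ
    middle   : endpoint (point x d) u ≡ point (x + length (offsets d u)) height
    rest     : Stays (x + length (offsets d u)) height v
    offsets≡ : offsets d (u ++ v) ≡ offsets d u ++ offsets height v

stays-++ : ∀ {x d} u {v} → Stays x d (u ++ v) → Split x d u v
stays-++ {x} {d} [] {v} s = record
  { middle = cong (λ y → point y d) (sym (+-identityʳ x))
  ; rest = subst (λ y → Stays y d v) (sym (+-identityʳ x)) s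
  ; offsets≡ = refl }
stays-++ {x} {d} (east ∷ u) {v} (east∷ _ s) = record
  { middle   = trans (cong (λ p → endpoint p u) (move-east x d))
                 (trans middle (cong (λ y → point y height) (sym (+-suc x _))))
  ; rest     = subst (λ y → Stays y height v) (sym (+-suc x _)) rest
  ; offsets≡ = cong (d ∷_) offsets≡ }
  where open Split (stays-++ u s)
stays-++ {x} {d} (north ∷ u) (north∷ _ s) = record
  { middle = trans (cong (λ p → endpoint p u) (move-north x d)) middle ; rest = rest ; offsets≡ = offsets≡ }
  where open Split (stays-++ u s)
stays-++ {x} {suc d} (south ∷ u) (south∷ _ s) = record
  { middle = trans (cong (λ p → endpoint p u) (move-south x d)) middle ; rest = rest ; offsets≡ = offsets≡ }
  where open Split (stays-++ u s)

-- One of the two truncated differences is 0, so the run never reverses.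
vertical : ℕ → ℕ → List Step
vertical d a = replicate (d ∸ a) south ++ replicate (a ∸ d) north

walk : ℕ → List ℕ → List Step
walk d []       = replicate d south
walk d (a ∷ as) = vertical d a ++ east ∷ walk (suc a) as

vertical-refl : ∀ d → vertical d d ≡ []
vertical-refl d rewrite n∸n≡0 d = refl

vertical-north : ∀ {d a} → d < a → vertical d a ≡ north ∷ vertical (suc d) a
vertical-north {d} {a} d<a
  rewrite m≤n⇒m∸n≡0 (<⇒≤ d<a) | m≤n⇒m∸n≡0 d<a = cong (λ k → replicate k north) (lemma d<a)
  where
  lemma : ∀ {d a} → d < a → a ∸ d ≡ suc (a ∸ suc d)
  lemma {zero}  {suc a} _         = refl
  lemma {suc d} {suc a} (s≤s d<a) = lemma d<a

vertical-south : ∀ {d a} → a ≤ d → vertical (suc d) a ≡ south ∷ vertical d a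
vertical-south {d} {a} a≤d
  rewrite +-∸-assoc 1 a≤d | m≤n⇒m∸n≡0 a≤d | m≤n⇒m∸n≡0 (m≤n⇒m≤1+n a≤d) = refl

-- Without reversals a vertical run is forced by its two ends: a first step away from the target
-- height would make the rest start with the opposite step.
walk-offsets : ∀ {x d w} → Linked MayFollow w → Stays x d w → w ≡ walk d (offsets d w)
walk-offsets l [] = refl
walk-offsets {d = d} {east ∷ w} l (east∷ _ s) rewrite vertical-refl d =
  cong (east ∷_) (walk-offsets (Linked.tail l) s)
walk-offsets {d = d} {north ∷ w} l (north∷ _ s) with offsets (suc d) w | walk-offsets (Linked.tail l) s
... | [] | refl with (f ∷ _) ← l = ⊥-elim (proj₁ f (refl , refl))
... | a ∷ as | eq with d <? a
...   | yes d<a rewrite vertical-north d<a = cong (north ∷_) eq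
...   | no d≮a rewrite vertical-south (≮⇒≥ d≮a) | eq with (f ∷ _) ← l = ⊥-elim (proj₁ f (refl , refl))
walk-offsets {d = suc d} {south ∷ w} l (south∷ _ s) with offsets d w | walk-offsets (Linked.tail l) s
... | [] | eq = cong (south ∷_) eq
... | a ∷ as | eq with d <? a
...   | no d≮a rewrite vertical-south (≮⇒≥ d≮a) = cong (south ∷_) eq
...   | yes d<a rewrite vertical-north d<a | eq with (f ∷ _) ← l = ⊥-elim (proj₂ f (refl , refl))

data BoundedFrom : ℕ → List ℕ → Set where
  []  : ∀ {x} → BoundedFrom x []
  _∷_ : ∀ {x a as} → a ≤ 2 * x → BoundedFrom (suc x) as → BoundedFrom x (a ∷ as)

stays-bounded : ∀ {x d w} → Stays x d w → BoundedFrom x (offsets d w)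
stays-bounded []            = []
stays-bounded (east∷ le s)  = le ∷ stays-bounded s
stays-bounded (north∷ _ s)  = stays-bounded s
stays-bounded (south∷ _ s)  = stays-bounded s

boundedFrom-mono : ∀ {x y as} → x ≤ y → BoundedFrom x as → BoundedFrom y as
boundedFrom-mono x≤y []       = []
boundedFrom-mono x≤y (a≤ ∷ b) = ≤-trans a≤ (*-monoʳ-≤ 2 x≤y) ∷ boundedFrom-mono (s≤s x≤y) b

-- Seen from `corner b`, the line `y = x - 2b` is the upper wall of a fresh wedge, and `i` counts
-- columns from that corner.
below⇔bounded : ∀ b {i} as → All (WeaklyBelow b) (eastPoints (i + b) as) ⇔ BoundedFrom i as
below⇔bounded b {i} [] = mk⇔ (λ _ → []) (λ _ → [])
below⇔bounded b {i} (a ∷ as) = mk⇔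
  (λ { (p ∷ ps) → +-cancelʳ-≤ (2 * b) a (2 * i) (subst (a + 2 * b ≤_) (*-distribˡ-+ 2 i b) (to (below-⇔ b (i + b) a) p))
                  ∷ to (below⇔bounded b as) ps })
  (λ { (a≤ ∷ bd) → from (below-⇔ b (i + b) a) (subst (a + 2 * b ≤_) (sym (*-distribˡ-+ 2 i b)) (+-monoˡ-≤ (2 * b) a≤))
                  ∷ from (below⇔bounded b as) bd })
  where open Equivalence

climb : ∀ {x d a w} → a ≤ 2 * x → d ≤ 2 * x → Stays x a w → Stays x d (vertical d a ++ w)
climb {x} {d} {a} {w} a≤ d≤ s with ≤-total d a
... | inj₁ d≤a rewrite m≤n⇒m∸n≡0 d≤a = up (a ∸ d) (m∸n+n≡m d≤a)
  where
  up : ∀ k {d} → k + d ≡ a → Stays x d (replicate k north ++ w)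
  up zero    refl = s
  up (suc k) {d} eq = north∷ (≤-trans (m≤n+m d (suc k)) (≤-trans (≤-reflexive eq) a≤))
                             (up k (trans (+-suc k d) eq))
... | inj₂ a≤d rewrite m≤n⇒m∸n≡0 a≤d | ++-assoc (replicate (d ∸ a) south) [] w =
  down (d ∸ a) (m∸n+n≡m a≤d) d≤
  where
  down : ∀ k {d} → k + a ≡ d → d ≤ 2 * x → Stays x d (replicate k south ++ w)
  down zero    refl _  = s
  down (suc k) refl d≤ = south∷ d≤ (down k refl (≤-trans (n≤1+n _) d≤))

descend : ∀ {x} d → d ≤ 2 * x → Stays x d (replicate d south)
descend zero    _  = []
descend (suc d) d≤ = south∷ d≤ (descend d (≤-trans (n≤1+n d) d≤))

stays-walk : ∀ {x d as} → d ≤ 2 * x → BoundedFrom x as → Stays x d (walk d as)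
stays-walk d≤ []       = descend _ d≤
stays-walk {x} {d} {a ∷ as} d≤ (a≤ ∷ b) = climb a≤ d≤ (east∷ a≤ (stays-walk
  (subst (suc a ≤_) (sym (2*-suc x)) (s≤s (m≤n⇒m≤1+n a≤))) b))

offsets-vertical : ∀ d a w → offsets d (vertical d a ++ w) ≡ offsets a w
offsets-vertical d a w with ≤-total d a
... | inj₁ d≤a rewrite m≤n⇒m∸n≡0 d≤a = up (a ∸ d) (m∸n+n≡m d≤a)
  where
  up : ∀ k {d} → k + d ≡ a → offsets d (replicate k north ++ w) ≡ offsets a w
  up zero    refl   = refl
  up (suc k) {d} eq = up k (trans (+-suc k d) eq)
... | inj₂ a≤d rewrite m≤n⇒m∸n≡0 a≤d | ++-assoc (replicate (d ∸ a) south) [] w = down (d ∸ a) (m∸n+n≡m a≤d)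
  where
  down : ∀ k {d} → k + a ≡ d → offsets d (replicate k south ++ w) ≡ offsets a w
  down zero    refl = refl
  down (suc k) refl = down k refl

offsets-walk : ∀ d as → offsets d (walk d as) ≡ as
offsets-walk zero    []       = refl
offsets-walk (suc d) []       = offsets-walk d []
offsets-walk d       (a ∷ as) = trans (offsets-vertical d a _) (cong (a ∷_) (offsets-walk (suc a) as))

mayFollow-east : ∀ {s} → MayFollow s east
mayFollow-east = (λ ()) , (λ ())

east-mayFollow : ∀ {s} → MayFollow east s
east-mayFollow = (λ ()) , (λ ())

mayFollow-refl : ∀ {s} → MayFollow s s
mayFollow-refl {s} = (λ { (refl , ()) }) , (λ { (refl , ()) })

linked-replicate : ∀ k {s} → Linked MayFollow (replicate k s)
linked-replicate zero          = []
linked-replicate (suc zero)    = [-]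
linked-replicate (suc (suc k)) = mayFollow-refl ∷ linked-replicate (suc k)

linked-replicate-east : ∀ k {s w} → Linked MayFollow (east ∷ w) → Linked MayFollow (replicate k s ++ east ∷ w)
linked-replicate-east zero          l = l
linked-replicate-east (suc zero)    l = mayFollow-east ∷ l
linked-replicate-east (suc (suc k)) l = mayFollow-refl ∷ linked-replicate-east (suc k) l

linked-east∷ : ∀ {w} → Linked MayFollow w → Linked MayFollow (east ∷ w)
linked-east∷ []        = [-]
linked-east∷ [-]       = east-mayFollow ∷ [-]
linked-east∷ (f ∷ l)   = east-mayFollow ∷ f ∷ l

linked-vertical : ∀ d a {w} → Linked MayFollow (east ∷ w) → Linked MayFollow (vertical d a ++ east ∷ w)
linked-vertical d a {w} l with ≤-total d a
... | inj₁ d≤a rewrite m≤n⇒m∸n≡0 d≤a = linked-replicate-east (a ∸ d) l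
... | inj₂ a≤d rewrite m≤n⇒m∸n≡0 a≤d | ++-assoc (replicate (d ∸ a) south) [] (east ∷ w) =
  linked-replicate-east (d ∸ a) l

linked-walk : ∀ d as → Linked MayFollow (walk d as)
linked-walk d []       = linked-replicate d
linked-walk d (a ∷ as) = linked-vertical d a (linked-east∷ (linked-walk (suc a) as))

risesFrom : ℕ → List ℕ → ℕ
risesFrom d []       = 0
risesFrom d (a ∷ as) = (a ∸ d) + risesFrom (suc a) as

count-++ : ∀ s u v → count s (u ++ v) ≡ count s u + count s v
count-++ s u v = trans (cong length (filter-++ (s ≟_) u v)) (length-++ (filter (s ≟_) u))

count-replicate : ∀ s k → count s (replicate k s) ≡ k
count-replicate s k = trans (cong length (filter-all (s ≟_) (All.replicate⁺ k refl))) (length-replicate k)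

count-replicate-≢ : ∀ {s t} → s ≢ t → ∀ k → count s (replicate k t) ≡ 0
count-replicate-≢ {s} s≢t k = cong length (filter-none (s ≟_) (All.replicate⁺ k s≢t))

north≢south : north ≢ south
north≢south ()

count-north-vertical : ∀ d a → count north (vertical d a) ≡ a ∸ d
count-north-vertical d a = trans (count-++ north (replicate (d ∸ a) south) _)
  (cong₂ _+_ (count-replicate-≢ north≢south (d ∸ a)) (count-replicate north (a ∸ d)))

count-north-walk : ∀ d as → count north (walk d as) ≡ risesFrom d as
count-north-walk d []       = count-replicate-≢ north≢south d
count-north-walk d (a ∷ as) = trans (count-++ north (vertical d a) _)
  (cong₂ _+_ (count-north-vertical d a) (count-north-walk (suc a) as))

-- `rises` reads the walk from its last east step and `risesFrom` from its first; `top s` is the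
-- height where the two readings meet.
rises-ʳ++ : ∀ as s → rises (as ʳ++ s) ≡ rises s + risesFrom (top s) as
rises-ʳ++ []       s = sym (+-identityʳ (rises s))
rises-ʳ++ (a ∷ as) s = trans (rises-ʳ++ as (a ∷ s)) (+-assoc (rises s) (a ∸ top s) _)

bounded-ʳ++⁺ : ∀ {s as} → Bounded s → BoundedFrom (length s) as → Bounded (as ʳ++ s)
bounded-ʳ++⁺ bs []       = bs
bounded-ʳ++⁺ bs (a≤ ∷ b) = bounded-ʳ++⁺ (a≤ ∷ bs) b

bounded-ʳ++⁻ : ∀ {s} as → Bounded (as ʳ++ s) → Bounded s × BoundedFrom (length s) as
bounded-ʳ++⁻ []       bs = bs , []
bounded-ʳ++⁻ (a ∷ as) bs with a≤ ∷ bs′ , b ← bounded-ʳ++⁻ as bs = bs′ , a≤ ∷ b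

count-east : ∀ d w → count east w ≡ length (offsets d w)
count-east d []          = refl
count-east d (east ∷ w)  = cong suc (count-east (suc d) w)
count-east d (north ∷ w) = count-east (suc d) w
count-east d (south ∷ w) = count-east (pred d) w

finalDescent : List Step → ℕ
finalDescent w = count south (takeWhile (λ s → ¬? (s ≟ east)) (reverse w))

finalDescent-replicate : ∀ u k → finalDescent (u ++ east ∷ replicate k south) ≡ k
finalDescent-replicate u k = trans (cong (count south ∘ takeWhile _) reversed) (leading k)
  where
  open ≡-Reasoning
  reversed : reverse (u ++ east ∷ replicate k south) ≡ replicate k south ++ east ∷ reverse u
  reversed = begin
    reverse (u ++ east ∷ replicate k south) ≡⟨ reverse-++ u (east ∷ replicate k south) ⟩
    reverse (east ∷ replicate k south) ++ reverse u ≡⟨ cong (_++ reverse u) (ʳ++-defn (replicate k south) {east ∷ []}) ⟩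
    (reverse (replicate k south) ++ east ∷ []) ++ reverse u
      ≡⟨ ++-assoc (reverse (replicate k south)) (east ∷ []) (reverse u) ⟩
    reverse (replicate k south) ++ east ∷ reverse u ≡⟨ ʳ++-defn (replicate k south) ⟨
    replicate k south ʳ++ east ∷ reverse u ≡⟨ accumulate k _ ⟩
    replicate k south ++ east ∷ reverse u ∎
    where
    accumulate : ∀ k w → replicate k south ʳ++ w ≡ replicate k south ++ w
    accumulate zero    w = refl
    accumulate (suc k) w = trans (accumulate k (south ∷ w)) (shift k)
      where
      shift : ∀ k → replicate k south ++ south ∷ w ≡ south ∷ replicate k south ++ w
      shift zero    = refl
      shift (suc k) = cong (south ∷_) (shift k)
  leading : ∀ k {w} → count south (takeWhile (λ s → ¬? (s ≟ east)) (replicate k south ++ east ∷ w)) ≡ k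
  leading zero    = refl
  leading (suc k) = cong suc (leading k)

-- A last east step at height `b` ends at height `suc b`, and only a descent to 0 follows.
walk-last : ∀ d a as s → ∃₂ λ u b → ∃ λ t →
  walk d (a ∷ as) ≡ u ++ east ∷ replicate (suc b) south × (a ∷ as) ʳ++ s ≡ b ∷ t
walk-last d a []       s = vertical d a , a , s , refl , refl
walk-last d a (b ∷ as) s with u , c , t , eq , eq′ ← walk-last (suc a) b as (a ∷ s) =
  vertical d a ++ east ∷ u , c , t ,
  trans (cong (λ w → vertical d a ++ east ∷ w) eq) (sym (++-assoc (vertical d a) (east ∷ u) _)) , eq′

finalDescent-walk : ∀ as → as ≢ [] → ∃ λ t → ∃ λ b → reverse as ≡ b ∷ t × finalDescent (walk 0 as) ≡ suc b
finalDescent-walk []       ne = ⊥-elim (ne refl)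
finalDescent-walk (a ∷ as) _  with u , b , t , eq , eq′ ← walk-last 0 a as [] =
  t , b , eq′ , trans (cong finalDescent eq) (finalDescent-replicate u (suc b))

∣x+offset∣ : ∀ x d → ∣ + x ℤ.+ (+ d ℤ.- + x) ∣ ≡ d
∣x+offset∣ x d = cong ∣_∣ (lemma (+ d) (+ x))
  where
  lemma : ∀ d x → x ℤ.+ (d ℤ.- x) ≡ d
  lemma = ℤ-solve-∀

sum-eastPoints : ∀ x as → sum (map (λ (x , y) → ∣ x ℤ.+ y ∣) (eastPoints x as)) ≡ sum as
sum-eastPoints x []       = refl
sum-eastPoints x (a ∷ as) = cong₂ _+_ (∣x+offset∣ x a) (sum-eastPoints (suc x) as)

-- The bijection and its statistics

pathOffsets : ∀ {n} → PDSAW n → List ℕ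
pathOffsets P = offsets 0 (PDSAW.steps P)

pathCode : ∀ {n} → PDSAW n → List ℕ
pathCode P = reverse (pathOffsets P)

module _ {n} (P : PDSAW n) where
  open PDSAW P

  path-stays : Stays 0 0 steps
  path-stays = stays⁺ 0 0 steps inWedge ends

  path-walk : steps ≡ walk 0 (pathOffsets P)
  path-walk = walk-offsets noReversal path-stays

  length-pathOffsets : length (pathOffsets P) ≡ n
  length-pathOffsets = trans (sym (count-east 0 steps)) eastCount

  length-pathCode : length (pathCode P) ≡ n
  length-pathCode = trans (length-reverse (pathOffsets P)) length-pathOffsets

  pathCode-bounded : Bounded (pathCode P)
  pathCode-bounded = bounded-ʳ++⁺ [] (stays-bounded path-stays)

  northSteps-rises : northSteps P ≡ rises (pathCode P)
  northSteps-rises = begin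
    count north steps                     ≡⟨ cong (count north) path-walk ⟩
    count north (walk 0 (pathOffsets P))  ≡⟨ count-north-walk 0 (pathOffsets P) ⟩
    risesFrom 0 (pathOffsets P)           ≡⟨ rises-ʳ++ (pathOffsets P) [] ⟨
    rises (pathCode P)                    ∎
    where open ≡-Reasoning

  area-sum : area P ≡ sum (pathCode P)
  area-sum = begin
    sum (map _ (eastSteps (point 0 0) steps)) ≡⟨ cong (sum ∘ map _) (stays-eastSteps path-stays) ⟩
    sum (map _ (eastPoints 0 (pathOffsets P))) ≡⟨ sum-eastPoints 0 (pathOffsets P) ⟩
    sum (pathOffsets P) ≡⟨ sum-↭ (↭-reverse (pathOffsets P)) ⟨
    sum (pathCode P) ∎
    where open ≡-Reasoning

lastDescent-head : ∀ {n} (P : PDSAW (suc n)) → ∃ λ t → ∃ λ b → pathCode P ≡ b ∷ t × lastDescent P ≡ suc b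
lastDescent-head P
  with t , b , eq , eq′ ← finalDescent-walk (pathOffsets P)
         (λ empty → 0≢1+n (trans (sym (cong length empty)) (length-pathOffsets P))) =
  t , b , eq , trans (cong finalDescent (path-walk P)) eq′

path : ∀ {s} → Bounded s → PDSAW (length s)
path {s} bs = record
  { steps      = walk 0 as
  ; noReversal = linked-walk 0 as
  ; inWedge    = stays-inWedge stays
  ; ends       = subst OnAntidiagonal (sym (stays-endpoint stays)) (antidiagonal⁺ _)
  ; eastCount  = trans (count-east 0 (walk 0 as)) (trans (cong length (offsets-walk 0 as)) (length-reverse s))
  }
  where
  as = reverse s
  stays : Stays 0 0 (walk 0 as)
  stays = stays-walk z≤n (proj₂ (bounded-ʳ++⁻ as (subst Bounded (sym (reverse-involutive s)) bs)))

pathCode-path : ∀ {s} (bs : Bounded s) → pathCode (path bs) ≡ s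
pathCode-path {s} bs = trans (cong reverse (offsets-walk 0 (reverse s))) (reverse-involutive s)

module _ {n} (P : PDSAW n) where

  imageCode : List ℕ
  imageCode = transform (pathCode P)

  length-imageCode : length imageCode ≡ n
  length-imageCode = trans (length-transform (pathCode P)) (length-pathCode P)

  image : Matching n
  image = record
    { blocks    = blocks imageCode
    ; ordered   = blocks-ordered imageCode
    ; sorted    = blocks-sorted imageCode
    ; partition = subst (λ m → elements (blocks imageCode) ↭ interval (2 * m)) length-imageCode
                    (blocks-partition (transform-bounded (pathCode-bounded P)))
    }

steps-injective : ∀ {m n} (P : PDSAW m) (Q : PDSAW n) → pathCode P ≡ pathCode Q → PDSAW.steps P ≡ PDSAW.steps Q
steps-injective P Q eq = begin
  PDSAW.steps P          ≡⟨ path-walk P ⟩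
  walk 0 (pathOffsets P) ≡⟨ cong (walk 0) (reverse-injective {x = pathOffsets P} {y = pathOffsets Q} eq) ⟩
  walk 0 (pathOffsets Q) ≡⟨ path-walk Q ⟨
  PDSAW.steps Q          ∎
  where open ≡-Reasoning

bijection : ∀ n → Bijection (PDSAWs n) (Matchings n)
bijection n = record
  { to        = image
  ; cong      = cong (λ w → blocks (transform (reverse (offsets 0 w))))
  ; bijective = (λ {P} {Q} → injective P Q) , surjective
  }
  where
  injective : ∀ (P Q : PDSAW n) → Matching.blocks (image P) ≡ Matching.blocks (image Q) → PDSAW.steps P ≡ PDSAW.steps Q
  injective P Q eq = steps-injective P Q (transform-injective (pathCode-bounded P) (pathCode-bounded Q)
    (trans (length-pathCode P) (sym (length-pathCode Q))) (blocks-injective eq))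
  surjective : ∀ (μ : Matching n) → ∃ λ P → ∀ {Q : PDSAW n} → PDSAW.steps Q ≡ PDSAW.steps P →
               Matching.blocks (image Q) ≡ Matching.blocks μ
  surjective μ
    with t , bt , refl , eq ← blocks-surjective n (Matching.blocks μ) (Matching.ordered μ) (Matching.sorted μ) (Matching.partition μ)
    with s , bs , len , eq′ ← transform-surjective bt =
    subst PDSAW len (path bs) , λ {Q} → fibre len Q
    where
    -- Generalised over the size, since `len` equates two lengths and could not otherwise be matched
    -- with `refl` to remove the `subst`.
    fibre : ∀ {n} (len : length s ≡ n) (Q : PDSAW n) → PDSAW.steps Q ≡ PDSAW.steps (subst PDSAW len (path bs)) →
            Matching.blocks (image Q) ≡ Matching.blocks μ
    fibre refl Q steps≡ = trans
      (cong blocks (trans (cong transform (trans (cong (reverse ∘ offsets 0) steps≡) (pathCode-path bs))) eq′)) eq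

image-head : ∀ {n} (P : PDSAW (suc n)) → ∃₂ λ p t → imageCode P ≡ p ∷ t × lastDescent P ≡ suc p
image-head P with s , p , eq , desc ← lastDescent-head P
  with t , eq′ ← transform-∷ (subst Bounded eq (pathCode-bounded P)) =
  p , t , trans (cong transform eq) eq′ , desc

descent⇔matched : ∀ p {t j} (μ : Matching j) → Matching.blocks μ ≡ blocks (p ∷ t) → ∀ M →
                  + suc p ≡ M - 1ℤ ⇔ OneMatchedWith μ M
descent⇔matched p {t} μ eq M = mk⇔
  (λ descent → 2 + p , trans (sym (cancel M)) (trans (cong (ℤ._+ 1ℤ) (sym descent)) (cong +_ (+-comm (suc p) 1))) ,
    subst ((1 , 2 + p) ∈_) (sym eq) (here refl))
  (λ (j , M≡j , 1j∈) →
    sym (trans (cong (_- 1ℤ) M≡j) (cong (λ j → + j - 1ℤ) (blocks-head {p} {t} (subst ((1 , j) ∈_) eq 1j∈)))))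
  where
  cancel : ∀ m → (m - 1ℤ) ℤ.+ 1ℤ ≡ m
  cancel = ℤ-solve-∀

statistics : ∀ n → .{{_ : NonZero n}} → (P : PDSAW n) → (N M : ℤ) → (A : Fin 2) →
  ( + northSteps P ≡ N × area P % 2 ≡ toℕ A × + lastDescent P ≡ M - 1ℤ )
  ⇔
  ( + nestings (image P) ≡ N × crossings (image P) % 2 ≡ toℕ A × OneMatchedWith (image P) M )
statistics (suc n) P N M A with p , t , code , desc ← image-head P = ×-⇔
  (≡-⇔ (cong +_ (trans (northSteps-rises P) (sym (nestings-transform (pathCode-bounded P))))))
  (×-⇔ (≡-⇔ (trans (cong (_% 2) (area-sum P)) (sym (crossings-transform (pathCode-bounded P)))))
       (subst (λ d → + d ≡ M - 1ℤ ⇔ OneMatchedWith (image P) M) (sym desc)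
              (descent⇔matched p (image P) (cong blocks code) M)))
  where
  ≡-⇔ : ∀ {A : Set} {x y z : A} → x ≡ y → (x ≡ z) ⇔ (y ≡ z)
  ≡-⇔ refl = mk⇔ id id

-- Prime factors

-- The common form of primality for paths and matchings: the list is no concatenation of two shorter
-- nonempty codes. Boundedness of `v` is not asked for, as suffixes of bounded lists inherit it.
Irreducible : List ℕ → Set
Irreducible y = ∀ u v → y ≡ u ++ v → Bounded u → 0 < length u → ¬ length u < length y

bounded-suffix : ∀ {s} u {v} → s ≡ u ++ v → Bounded s → Bounded v
bounded-suffix []      refl bs       = bs
bounded-suffix (_ ∷ u) refl (_ ∷ bs) = bounded-suffix u refl bs

-- `transform` is a length-preserving bijection respecting concatenation, so a splitting of the
-- image pulls back to one of `y`.
transform-irreducible : ∀ {y} → Bounded y → Irreducible y → Irreducible (transform y)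
transform-irreducible {y} by irr u v eq bu 0<u u<
  with bv ← bounded-suffix u eq (transform-bounded by)
  with u′ , bu′ , lenu , refl ← transform-surjective bu
     | v′ , bv′ , lenv , refl ← transform-surjective bv =
  irr u′ v′
    (transform-injective by (++-bounded bu′ bv′) lengths (trans eq (sym (transform-++ bu′ bv′))))
    bu′ (subst (0 <_) (sym lenu) 0<u) (subst₂ _<_ (sym lenu) (length-transform y) u<)
  where
  open ≡-Reasoning
  lengths = begin
    length y ≡⟨ length-transform y ⟨
    length (transform y) ≡⟨ cong length eq ⟩
    length (transform u′ ++ transform v′) ≡⟨ length-++ (transform u′) ⟩
    length (transform u′) + length (transform v′) ≡⟨ cong₂ _+_ lenu lenv ⟨
    length u′ + length v′ ≡⟨ length-++ u′ ⟨
    length (u′ ++ v′) ∎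

blocks-range : ∀ {s} → Bounded s →
  All (λ (i , j) → InInterval 0 (2 * length s) i × InInterval 0 (2 * length s) j) (blocks s)
blocks-range bs = All.tabulate λ b∈ →
  ∈-interval⁻ (∈-resp-↭ (blocks-partition bs) (∈-elements₁ b∈)) ,
  ∈-interval⁻ (∈-resp-↭ (blocks-partition bs) (∈-elements₂ b∈))

++-overlap : ∀ (u : List ℕ) {v} y {z} → u ++ v ≡ y ++ z → length u ≤ length y → ∃ λ v′ → y ≡ u ++ v′
++-overlap []      y       _  _        = y , refl
++-overlap (a ∷ u) (b ∷ y) eq (s≤s le)
  with refl ← ∷-injectiveˡ eq
  with v′ , refl ← ++-overlap u y (∷-injectiveʳ eq) le = v′ , refl

module _ {n} (μ : Matching n) {x y z : List ℕ} (bx : Bounded x) (by : Bounded y) (bz : Bounded z)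
         (blocks≡ : Matching.blocks μ ≡ blocks (x ++ y ++ z)) (n≡ : n ≡ length (x ++ y ++ z)) where

  private
    a b : ℕ
    a = 2 * length x
    b = a + 2 * length y

    Left Middle Right : Block → Set
    Left   (i , j) = i ≤ a × j ≤ a
    Middle (i , j) = InInterval a b i × InInterval a b j
    Right  (i , j) = b < i × b < j

    tail≡ : map (shiftBlock a) (blocks (y ++ z)) ≡ map (shiftBlock a) (blocks y) ++ map (shiftBlock b) (blocks z)
    tail≡ = begin
      map (shiftBlock a) (blocks (y ++ z))
        ≡⟨ cong (map (shiftBlock a)) (blocks-++ z by) ⟩
      map (shiftBlock a) (blocks y ++ map (shiftBlock (2 * length y)) (blocks z))
        ≡⟨ map-++ (shiftBlock a) (blocks y) _ ⟩
      map (shiftBlock a) (blocks y) ++ map (shiftBlock a) (map (shiftBlock (2 * length y)) (blocks z))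
        ≡⟨ cong (map (shiftBlock a) (blocks y) ++_) (trans (sym (map-∘ (blocks z)))
             (map-cong (λ (i , j) → cong₂ _,_ (sym (+-assoc a _ i)) (sym (+-assoc a _ j))) (blocks z))) ⟩
      map (shiftBlock a) (blocks y) ++ map (shiftBlock b) (blocks z) ∎
      where open ≡-Reasoning

    left : All Left (blocks x)
    left = All.map (λ ((_ , i≤) , (_ , j≤)) → i≤ , j≤) (blocks-range bx)

    middle : All Middle (map (shiftBlock a) (blocks y))
    middle = All.map⁺ (All.map (λ (i∈ , j∈) → shifted i∈ , shifted j∈) (blocks-range by))
      where
      shifted : ∀ {i} → InInterval 0 (2 * length y) i → InInterval a b (a + i)
      shifted (0<i , i≤) = m<m+n a 0<i , +-monoʳ-≤ a i≤

    right : All Right (map (shiftBlock b) (blocks z))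
    right = All.map⁺ (All.map (λ ((0<i , _) , (0<j , _)) → m<m+n b 0<i , m<m+n b 0<j) (blocks-range bz))

    decomposition : Matching.blocks μ ≡
                    blocks x ++ map (shiftBlock a) (blocks y) ++ map (shiftBlock b) (blocks z)
    decomposition = trans blocks≡ (trans (blocks-++ (y ++ z) bx) (cong (blocks x ++_) tail≡))

  matchingFactor : 0 < length y → IsMatchingFactor μ a b
  matchingFactor 0<y = record
    { nonempty = m<m+n a (≤-trans 0<y (m≤m+n _ _))
    ; inRange  = subst (b ≤_) (sym size) (m≤m+n b (2 * length z))
    ; closed   = subst (All _) (sym decomposition) (All.++⁺
        (All.map (λ (i≤ , j≤) → mk⇔ (λ (a<i , _) → ⊥-elim (≤⇒≯ i≤ a<i)) (λ (a<j , _) → ⊥-elim (≤⇒≯ j≤ a<j))) left)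
        (All.++⁺
          (All.map (λ (i∈ , j∈) → mk⇔ (λ _ → j∈) (λ _ → i∈)) middle)
          (All.map (λ (b<i , b<j) → mk⇔ (λ (_ , i≤) → ⊥-elim (≤⇒≯ i≤ b<i)) (λ (_ , j≤) → ⊥-elim (≤⇒≯ j≤ b<j))) right)))
    }
    where
    open ≡-Reasoning
    size : 2 * n ≡ b + 2 * length z
    size = begin
      2 * n ≡⟨ cong (2 *_) (trans n≡ (trans (length-++ x) (cong (λ m → length x + m) (length-++ y)))) ⟩
      2 * (length x + (length y + length z)) ≡⟨ lemma (length x) (length y) (length z) ⟩
      b + 2 * length z ∎
      where
      lemma : ∀ x y z → 2 * (x + (y + z)) ≡ 2 * x + 2 * y + 2 * z
      lemma = solve-∀

  matchingFactor-closed : ∀ {d} → IsMatchingFactor μ a (a + d) → All (λ (i , j) → i ≤ d ⇔ j ≤ d) (blocks (y ++ z))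
  matchingFactor-closed {d} f = All.zipWith relative (blocks-range (++-bounded by bz) , All.map⁻
    (All.++⁻ʳ (blocks x) (subst (All _) (trans blocks≡ (blocks-++ (y ++ z) bx)) (IsMatchingFactor.closed f))))
    where
    open Equivalence
    relative : ∀ {m b} → (InInterval 0 m (proj₁ b) × InInterval 0 m (proj₂ b)) ×
                       (InInterval a (a + d) (a + proj₁ b) ⇔ InInterval a (a + d) (a + proj₂ b)) →
               proj₁ b ≤ d ⇔ proj₂ b ≤ d
    relative {b = i , j} (((0<i , _) , (0<j , _)) , e) = mk⇔
      (λ i≤d → +-cancelˡ-≤ a j d (proj₂ (to e (m<m+n a 0<i , +-monoʳ-≤ a i≤d))))
      (λ j≤d → +-cancelˡ-≤ a i d (proj₂ (from e (m<m+n a 0<j , +-monoʳ-≤ a j≤d))))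

  -- Such a factor closes off the first `d` points of `blocks (y ++ z)`; by `closed-prefix` it comes
  -- from a bounded prefix of `y ++ z`, short enough to be a proper prefix of `y`.
  irreducible-minimal : Irreducible y → ∀ {d} → 0 < d → d < 2 * length y → ¬ IsMatchingFactor μ a (a + d)
  irreducible-minimal irreducible {d} 0<d d<y f
    with u , v , eq , bu , refl ← closed-prefix (++-bounded by bz) d
           (≤-trans (<⇒≤ d<y) (*-monoʳ-≤ 2 (subst (length y ≤_) (sym (length-++ y)) (m≤m+n _ _))))
           (matchingFactor-closed f)
    with v′ , y≡ ← ++-overlap u y (sym eq) (*-cancelˡ-≤ 2 (<⇒≤ d<y)) =
    irreducible u v′ y≡ bu (*-cancelˡ-< 2 0 (length u) 0<d) (*-cancelˡ-< 2 (length u) (length y) d<y)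

  primeMatchingFactor : 0 < length y → Irreducible y → IsPrimeMatchingFactor μ a b
  primeMatchingFactor 0<y irreducible = record { isFactor = matchingFactor 0<y ; minimal = minimal }
    where
    minimal : ∀ c → ¬ (IsMatchingFactor μ a c × IsMatchingFactor μ c b)
    minimal c (f , g) with d , refl ← m≤n⇒∃[o]m+o≡n (<⇒≤ (IsMatchingFactor.nonempty f)) =
      irreducible-minimal irreducible
        (+-cancelˡ-< a 0 d (subst (_< a + d) (sym (+-identityʳ a)) (IsMatchingFactor.nonempty f)))
        (+-cancelˡ-< a d (2 * length y) (IsMatchingFactor.nonempty g)) f

  restriction : ∀ {k} (ν : Matching k) → Matching.blocks ν ≡ blocks y → IsRestriction μ a b ν
  restriction ν ν≡ = sym (begin
    filter P? (Matching.blocks μ) ≡⟨ cong (filter P?) decomposition ⟩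
    filter P? (blocks x ++ bs ++ cs) ≡⟨ filter-++ P? (blocks x) _ ⟩
    filter P? (blocks x) ++ filter P? (bs ++ cs)
      ≡⟨ cong₂ _++_ (filter-none P? (All.map (λ (i≤ , _) (a<i , _) → ≤⇒≯ i≤ a<i) left)) (filter-++ P? bs cs) ⟩
    filter P? bs ++ filter P? cs
      ≡⟨ cong₂ _++_ (filter-all P? (All.map proj₁ middle)) (filter-none P? (All.map (λ (b<i , _) (_ , i≤) → ≤⇒≯ i≤ b<i) right)) ⟩
    bs ++ [] ≡⟨ ++-identityʳ bs ⟩
    bs ≡⟨ cong (map (shiftBlock a)) ν≡ ⟨
    map (shiftBlock a) (Matching.blocks ν) ∎)
    where
    open ≡-Reasoning
    bs = map (shiftBlock a) (blocks y)
    cs = map (shiftBlock b) (blocks z)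
    P? : (p : Block) → Dec (a < proj₁ p × proj₁ p ≤ b)
    P? (i , _) = a <? i ×-dec i ≤? b

-- Factors of a path as splittings of its heights

stays-suffix : ∀ {x d u v} → Stays x d u → Stays x d (u ++ v) →
               Stays (x + length (offsets d u)) 0 v × offsets d (u ++ v) ≡ offsets d u ++ offsets 0 v
stays-suffix {x} {v = v} [] s = subst (λ x → Stays x 0 v) (sym (+-identityʳ x)) s , refl
stays-suffix {x} {d} {v = v} (east∷ _ t) (east∷ _ s) with r , eq ← stays-suffix t s =
  subst (λ x → Stays x 0 v) (sym (+-suc x _)) r , cong (d ∷_) eq
stays-suffix (north∷ _ t) (north∷ _ s) = stays-suffix t s
stays-suffix (south∷ _ t) (south∷ _ s) = stays-suffix t s

boundedFrom-++⁻ : ∀ {x} as {cs} → BoundedFrom x (as ++ cs) → BoundedFrom x as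
boundedFrom-++⁻ []       _        = []
boundedFrom-++⁻ (a ∷ as) (a≤ ∷ b) = a≤ ∷ boundedFrom-++⁻ as b

boundedFrom-++⁺ : ∀ {x as cs} → BoundedFrom x as → BoundedFrom x cs → BoundedFrom x (as ++ cs)
boundedFrom-++⁺ []       b′ = b′
boundedFrom-++⁺ (a≤ ∷ b) b′ = a≤ ∷ boundedFrom-++⁺ b (boundedFrom-mono (n≤1+n _) b′)

-- An east step at height 0 is preceded by a full descent, and this is also how `walk d as` ends.
walk-++ : ∀ d as {c cs} → c ≤ 0 → walk d (as ++ c ∷ cs) ≡ walk d as ++ walk 0 (c ∷ cs)
walk-++ d []       {cs = cs} z≤n rewrite 0∸n≡0 d = ++-assoc (replicate d south) [] (east ∷ walk 1 cs)
walk-++ d (a ∷ as) c≤  =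
  trans (cong (λ w → vertical d a ++ east ∷ w) (walk-++ (suc a) as c≤)) (sym (++-assoc (vertical d a) _ _))

record FactorOffsets {n} (P : PDSAW n) (a b : ℕ) (w : List Step) : Set where
  field
    before after : List ℕ
    split        : pathOffsets P ≡ before ++ offsets 0 w ++ after
    start        : length before ≡ a
    end          : a + length (offsets 0 w) ≡ b
    bounded      : BoundedFrom 0 after

stays-from-corner : ∀ {x d u v a} → Stays x d (u ++ v) → endpoint (point x d) u ≡ corner a →
  x + length (offsets d u) ≡ a × Stays a 0 v × offsets d (u ++ v) ≡ offsets d u ++ offsets 0 v
stays-from-corner {u = u} {a = a} s eq
  with record { middle = middle ; rest = rest ; offsets≡ = offsets≡ } ← stays-++ u s
  with refl , refl ← point-injective (trans (sym middle) (trans eq (corner≡point a))) =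
  refl , rest , offsets≡

module _ {n} (P : PDSAW n) {a b w} (f : IsPathFactor P a b w) where
  open IsPathFactor f

  private
    starting = stays-from-corner {u = before} {a = a} (subst (Stays 0 0) split (path-stays P)) start
    a-stays : Stays a 0 (w ++ after)
    a-stays = proj₁ (proj₂ starting)
    ending = stays-from-corner {u = w} {a = b} a-stays (trans (cong (λ p → endpoint p w) (sym (corner≡point a))) end)
    b-stays : Stays b 0 after
    b-stays = proj₁ (proj₂ ending)

    belowEnd-bounded : BoundedFrom 0 (offsets 0 after)
    belowEnd-bounded = Equivalence.to (below⇔bounded b (offsets 0 after))
      (subst (All (WeaklyBelow b)) (trans (cong (λ p → eastSteps p after) (corner≡point b)) (stays-eastSteps b-stays)) belowEnd)

  factorOffsets : FactorOffsets P a b w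
  factorOffsets = record
    { before  = offsets 0 before
    ; after   = offsets 0 after
    ; split   = trans (cong (offsets 0) split)
                  (trans (proj₂ (proj₂ starting)) (cong (offsets 0 before ++_) (proj₂ (proj₂ ending))))
    ; start   = proj₁ starting
    ; end     = proj₁ ending
    ; bounded = belowEnd-bounded
    }

  -- `BoundedFrom 0` forces `c` to be 0, so the walk is back on `y = - x` after `y₁`. The steps of
  -- `after` lie below the line through the later corner, hence also below the line through the new
  -- one.
  shorterFactor : ∀ y₁ {c cs} → w ≡ walk 0 (y₁ ++ c ∷ cs) → BoundedFrom 0 y₁ → BoundedFrom 0 (c ∷ cs) →
                  0 < length y₁ → IsPathFactor P a (a + length y₁) (walk 0 y₁)
  shorterFactor y₁ {c} {cs} w≡ b₁ b₂@(c≤ ∷ _) 0<y₁ = record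
    { before     = before
    ; after      = w₂ ++ after
    ; split      = trans split (cong (before ++_) rest≡)
    ; start      = start
    ; end        = trans (cong (λ p → endpoint p w₁) (corner≡point a)) (trans (stays-endpoint w₁-stays)
                     (trans (cong (λ y → point (a + length y) 0) (offsets-walk 0 y₁)) (sym (corner≡point (a + length y₁)))))
    ; nonempty   = m<m+n a 0<y₁
    ; belowStart = subst (All (WeaklyBelow a) ∘ eastSteps (corner a)) rest≡ belowStart
    ; belowEnd   = subst (All (WeaklyBelow (a + length y₁))) (sym east≡)
                     (Equivalence.from (below⇔bounded (a + length y₁) {0} _) (boundedFrom-++⁺ b₂ belowEnd-bounded))
    }
    where
    w₁ = walk 0 y₁
    w₂ = walk 0 (c ∷ cs)
    rest≡ : w ++ after ≡ w₁ ++ (w₂ ++ after)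
    rest≡ = trans (cong (_++ after) (trans w≡ (walk-++ 0 y₁ c≤))) (++-assoc w₁ w₂ after)
    w₁-stays : Stays a 0 w₁
    w₁-stays = stays-walk z≤n (boundedFrom-mono z≤n b₁)
    middle-stays : Stays (a + length y₁) 0 (w₂ ++ after)
    middle-stays = subst (λ y → Stays (a + length y) 0 (w₂ ++ after)) (offsets-walk 0 y₁)
      (proj₁ (stays-suffix w₁-stays (subst (Stays a 0) rest≡ a-stays)))
    offsets≡ : offsets 0 (w₂ ++ after) ≡ (c ∷ cs) ++ offsets 0 after
    offsets≡ = trans
      (proj₂ (stays-suffix (stays-walk z≤n (boundedFrom-mono z≤n b₂)) middle-stays))
      (cong (_++ offsets 0 after) (offsets-walk 0 (c ∷ cs)))
    east≡ : eastSteps (corner (a + length y₁)) (w₂ ++ after) ≡ eastPoints (a + length y₁) ((c ∷ cs) ++ offsets 0 after)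
    east≡ = trans (cong (λ p → eastSteps p (w₂ ++ after)) (corner≡point (a + length y₁)))
      (trans (stays-eastSteps middle-stays) (cong (eastPoints (a + length y₁)) offsets≡))

-- Otherwise `shorterFactor` yields a factor with the same start that ends before `b`, against
-- minimality.
prime-indecomposable : ∀ {n k a b} (P : PDSAW n) (Q : PDSAW k) → IsPrimePathFactor P a b (PDSAW.steps Q) →
  ∀ y₁ y₂ → pathOffsets Q ≡ y₁ ++ y₂ → BoundedFrom 0 y₂ → 0 < length y₁ → ¬ 0 < length y₂
prime-indecomposable {a = a} {b} P Q f y₁ (c ∷ cs) y≡ b₂ 0<y₁ _ =
  <-irrefl b₁≡b (subst (a + length y₁ <_) end (+-monoʳ-< a (subst (length y₁ <_) (sym length≡) (m<m+n (length y₁) (s≤s z≤n)))))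
  where
  open IsPrimePathFactor f
  end : a + length (pathOffsets Q) ≡ b
  end = FactorOffsets.end (factorOffsets P isFactor)
  length≡ : length (pathOffsets Q) ≡ length y₁ + length (c ∷ cs)
  length≡ = trans (cong length y≡) (length-++ y₁)
  b₁ : BoundedFrom 0 y₁
  b₁ = boundedFrom-++⁻ y₁ (subst (BoundedFrom 0) y≡ (stays-bounded (path-stays Q)))
  b₁≤b : a + length y₁ ≤ b
  b₁≤b = subst (a + length y₁ ≤_) end (+-monoʳ-≤ a (subst (length y₁ ≤_) (sym length≡) (m≤m+n _ _)))
  b₁≡b : a + length y₁ ≡ b
  b₁≡b = proj₂ (minimal a (a + length y₁) (walk 0 y₁)
    (shorterFactor P isFactor y₁ (trans (path-walk Q) (cong (walk 0) y≡)) b₁ b₂ 0<y₁) ≤-refl b₁≤b)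

prime-irreducible : ∀ {n k a b} (P : PDSAW n) (Q : PDSAW k) → IsPrimePathFactor P a b (PDSAW.steps Q) →
                    Irreducible (pathCode Q)
prime-irreducible P Q f u v eq bu 0<u u<y = prime-indecomposable P Q f (reverse v) (reverse u)
  (trans (sym (reverse-involutive (pathOffsets Q))) (trans (cong reverse eq) (reverse-++ u v)))
  (proj₂ (bounded-ʳ++⁻ (reverse u) (subst Bounded (sym (reverse-involutive u)) bu)))
  (subst (0 <_) (sym (length-reverse v)) (+-cancelˡ-< (length u) 0 (length v)
    (subst₂ _<_ (sym (+-identityʳ (length u))) (trans (cong length eq) (length-++ u)) u<y)))
  (subst (0 <_) (sym (length-reverse u)) 0<u)

-- Reversing the heights turns the part after the factor into the prefix `x` of the code, which
-- occupies the leftmost points of the matching. So `m` counts the east steps after the factor.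
prime-factor-image : ∀ {n k a} (P : PDSAW n) (Q : PDSAW k) → 0 < k → IsPrimePathFactor P a (a + k) (PDSAW.steps Q) →
  ∃ λ m → m + k + a ≡ n ×
    IsPrimeMatchingFactor (image P) (2 * m) (2 * m + 2 * k) ×
    IsRestriction (image P) (2 * m) (2 * m + 2 * k) (image Q)
prime-factor-image {n} {k} {a} P Q 0<k f =
  length x , size ,
  subst₂ (λ l k → IsPrimeMatchingFactor (image P) (2 * l) (2 * l + 2 * k)) lx ly
    (primeMatchingFactor (image P) tx ty tz blocks≡ n≡ (subst (0 <_) (sym ly) 0<k)
      (transform-irreducible by (prime-irreducible P Q f))) ,
  subst₂ (λ l k → IsRestriction (image P) (2 * l) (2 * l + 2 * k) (image Q)) lx ly
    (restriction (image P) tx ty tz blocks≡ n≡ (image Q) refl)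
  where
  open FactorOffsets (factorOffsets P (IsPrimePathFactor.isFactor f))
  x y z : List ℕ
  x = reverse after
  y = pathCode Q
  z = reverse before
  code≡ : pathCode P ≡ x ++ y ++ z
  code≡ = begin
    reverse (pathOffsets P) ≡⟨ cong reverse split ⟩
    reverse (before ++ pathOffsets Q ++ after) ≡⟨ reverse-++ before _ ⟩
    reverse (pathOffsets Q ++ after) ++ z ≡⟨ cong (_++ z) (reverse-++ (pathOffsets Q) after) ⟩
    (x ++ y) ++ z ≡⟨ ++-assoc x y z ⟩
    x ++ y ++ z ∎
    where open ≡-Reasoning
  bx : Bounded x
  bx = bounded-ʳ++⁺ [] bounded
  by : Bounded y
  by = pathCode-bounded Q
  bz : Bounded z
  bz = bounded-suffix y refl (bounded-suffix x code≡ (pathCode-bounded P))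
  tx : Bounded (transform x)
  tx = transform-bounded bx
  ty : Bounded (transform y)
  ty = transform-bounded by
  tz : Bounded (transform z)
  tz = transform-bounded bz
  image≡ : imageCode P ≡ transform x ++ transform y ++ transform z
  image≡ = trans (cong transform code≡)
    (trans (transform-++ bx (++-bounded by bz)) (cong (transform x ++_) (transform-++ by bz)))
  blocks≡ : Matching.blocks (image P) ≡ blocks (transform x ++ transform y ++ transform z)
  blocks≡ = cong blocks image≡
  n≡ : n ≡ length (transform x ++ transform y ++ transform z)
  n≡ = trans (sym (length-imageCode P)) (cong length image≡)
  lx : length (transform x) ≡ length x
  lx = length-transform x
  ly : length (transform y) ≡ k
  ly = length-imageCode Q
  size : length x + k + a ≡ n
  size = begin
    length x + k + a                   ≡⟨ cong₂ (λ k a → length x + k + a) (length-pathCode Q) (trans (length-reverse before) start) ⟨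
    length x + length y + length z     ≡⟨ +-assoc (length x) (length y) (length z) ⟩
    length x + (length y + length z)   ≡⟨ cong (λ m → length x + m) (length-++ y) ⟨
    length x + length (y ++ z)         ≡⟨ length-++ x ⟨
    length (x ++ y ++ z)               ≡⟨ cong length code≡ ⟨
    length (pathCode P)                ≡⟨ length-pathCode P ⟩
    n                                  ∎
    where open ≡-Reasoning

-- The path is consumed from the left while the matching is filled from the right, so the images
-- accumulate as in `reverseAcc`. In `e + a ≡ n`, `a` east steps have been consumed and `νs` covers
-- the points after `2 * e`.
reassemble : ∀ {n} (P : PDSAW n) (μ : Matching n) (g : ∀ {k} → PDSAW k → Matching k) →
  (∀ {k a} (Q : PDSAW k) → 0 < k → IsPrimePathFactor P a (a + k) (PDSAW.steps Q) →
    ∃ λ m → m + k + a ≡ n ×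
      IsPrimeMatchingFactor μ (2 * m) (2 * m + 2 * k) × IsRestriction μ (2 * m) (2 * m + 2 * k) (g Q)) →
  ∀ {a Ps νs} e → e + a ≡ n → PrimePathFactorsFrom P a Ps → PrimeMatchingFactorsFrom μ (2 * e) νs →
  PrimeMatchingFactorsFrom μ 0 (reverseAcc νs (map (λ (k , k≢0 , Q) → k , k≢0 , g Q) Ps))
reassemble {n} P μ g step {νs = νs} e eq [] fs =
  subst (λ e → PrimeMatchingFactorsFrom μ (2 * e) νs) (+-cancelʳ-≡ n e 0 eq) fs
reassemble P μ g step {a} {νs = νs} e eq (_∷_ {k = k} {k≢0} {Q} f fs) gs
  with m , size , prime , restricted ← step Q (>-nonZero⁻¹ k {{k≢0}}) f =
  reassemble P μ g step {νs = (k , k≢0 , g Q) ∷ νs} m (trans (lemma m k a) size) fs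
    (_∷_ {a = 2 * m} {k} {k≢0} {g Q} {νs} (prime , restricted)
      (subst (λ i → PrimeMatchingFactorsFrom μ i νs) position gs))
  where
  lemma : ∀ m k a → m + (a + k) ≡ m + k + a
  lemma = solve-∀
  position : 2 * e ≡ 2 * m + 2 * k
  position = trans (cong (2 *_) (+-cancelʳ-≡ a e (m + k) (trans eq (sym size)))) (*-distribˡ-+ 2 m k)

theorem1p3 : Σ[ Φ ∈ (∀ n → .{{_ : NonZero n}} → Bijection (PDSAWs n) (Matchings n)) ]
    (∀ n → .{{_ : NonZero n}} → (P : PDSAW n) → (N M : ℤ) → (A : Fin 2) →
    ( + northSteps P ≡ N
    × area P % 2 ≡ toℕ A
    × + lastDescent P ≡ M - 1ℤ )
    ⇔
    ( + nestings (Bijection.to (Φ n) P) ≡ N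
    × crossings (Bijection.to (Φ n) P) % 2 ≡ toℕ A
    × OneMatchedWith (Bijection.to (Φ n) P) M ))
    ×
    (∀ n → .{{_ : NonZero n}} → (P : PDSAW n) → (Ps : List (SomePositive PDSAW)) →
    PrimePathFactors P Ps →
    PrimeMatchingFactors (Bijection.to (Φ n) P)
    (reverse (map (λ (k , k≢0 , Q) → k , k≢0 , Bijection.to (Φ k {{k≢0}}) Q) Ps)))
theorem1p3 =
  (λ n → bijection n) ,
  statistics ,
  (λ n P Ps fs → reassemble P (image P) image (λ {k} {a} → prime-factor-image {n} {k} {a} P) n (+-identityʳ n) fs [])
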